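{- Let $k$ be an algebraically closed field, let $A=kQ^{\bowtie}/I$ be a bound quiver algebra, and let $M(w)$ be the loop module over $A$ of a loopstring $w$, with associated loop graph $\mathcal G^{\bowtie}$. Then the perfect matching lattice $\mathcal L(\mathcal G)$ of the loop graph is in bijection with the canonical submodule lattice $\mathcal L(M(w))$.
   Context: **Snake and loop graphs.** A tile is a square with edges $N,S,E,W$. A snake graph $\mathcal G=(G_1,\dots,G_n)$ is a sequence of tiles in the plane where each $G_{i+1}$ is glued either on the right of $G_i$ ($E(G_i)=W(G_{i+1})$) or on top of $G_i$ ($N(G_i)=S(G_{i+1})$). A run of consecutive tiles is a zig-zag if no tile of the run has its two neighbours in the run glued at opposite edges. Let $n\ge 3$ and let $\{G_{i+1},\dots,G_n\}$, $i\ge1$, be the maximal zig-zag ending at $G_n$; let $c$ be the edge of $G_n$ sharing no vertex with $G_{n-1}$ and $c'$ the North or East edge of $G_i$ that is a boundary edge of $\mathcal G$. Identify $c$ with $c'$ so that the North-East vertex of $G_n$ goes to the endpoint of $c'$ different from the North-East vertex of $G_i$, and the other endpoint of $c$ goes to the North-East vertex of $G_i$ (a loop with respect to $G_n$ and $G_i$). Dually (rotating by $180^\circ$), with $\{G_1,\dots,G_j\}$ the maximal zig-zag starting at $G_1$, one glues an edge of $G_1$ to an edge of $G_{j+1}$ (a loop with respect to $G_1$ and $G_{j+1}$). A loop graph $\mathcal G^{\bowtie}$ is obtained from $\mathcal G$ by performing one or both of these gluings. **Perfect matching lattice.** A perfect matching of a graph is a set of edges such that each vertex is incident to exactly one of them.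 $\mathcal L(\mathcal G)$ is the lattice of perfect matchings of $\mathcal G^{\bowtie}$; two matchings are joined by an edge of the Hasse diagram when they agree everywhere except on one tile, on which they have opposite matchings (pairs of opposite edges). **Loopstrings and loop graphs.** A loopstring is a word in $\{\rightarrow,\leftarrow,\hookrightarrow,\hookleftarrow\}$ with at most two letters from $\{\hookrightarrow,\hookleftarrow\}$ (direct, inverse loop), which are never the first or last letter, such that for each direct (resp. inverse) loop either all letters before it, or all letters after it, are inverse (resp. direct) arrows. We write $w=a_1u_1a_2u_2\cdots u_{n-1}a_n$ where $u_i$ are the letters and $a_i$ are vertices of the quiver placed between letters. Its plain string replaces $\hookrightarrow$ by $\rightarrow$ and $\hookleftarrow$ by $\leftarrow$. The associated snake graph has tiles $G_1,\dots,G_n$ with $G_{i+1}$ on the right of $G_i$ if ($i$ odd and $u_i$ direct) or ($i$ even and $u_i$ inverse), and on top of $G_i$ otherwise. A loop letter $u_i$ preceded only by arrows of opposite direction (left loop) gives a gluing of $G_1$ with $G_{i+1}$; a loop letter $u_i$ followed only by arrows of opposite direction (right loop) gives a gluing of $G_n$ with $G_i$. The result is the loop graph $\mathcal G^{\bowtie}$ associated to $w$. **Loop module.** $M(w)$ has a standard basis $e_1,\dots,e_n$, with $e_i$ at the vertex $a_i$. Direct (inverse) $u_i$ means that an arrow of the quiver sends $e_i$ to $e_{i+1}$ ($e_{i+1}$ to $e_i$). In addition, for a left loop letter $u_i$ there is an arrow acting with identity entry from $e_1$ to $e_{i+1}$ if $u_i=\hookleftarrow$, and from $e_{i+1}$ to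 $e_1$ if $u_i=\hookrightarrow$; for a right loop letter $u_i$, from $e_i$ to $e_n$ if $u_i=\hookleftarrow$, and from $e_n$ to $e_i$ if $u_i=\hookrightarrow$. All other matrix entries are $0$. **Canonical submodule lattice.** A canonical submodule of $M(w)$ is a submodule $N$ together with its canonical embedding (identity on non-zero components), i.e. a submodule spanned by a subset of the standard basis, remembering the positions; equivalently it is obtained from $M(w)$ by successively removing simples in the top. $\mathcal L(M(w))$ is the set of canonical submodules ordered by inclusion; two are joined by an edge of the Hasse diagram if they differ in exactly one basis element.
   Formalization: The perfect matchings of the loop graph are restricted to those that extend to a perfect matching of the underlying snake graph; with all perfect matchings the claim fails, e.g. for → ↪ ← ← there are 12 matchings but 9 canonical submodules. -}

module Defs where

open import Algebra.Apartness.Bundles using (HeytingField; HeytingCommutativeRing)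
open import Algebra.Bundles using (CommutativeRing)
import Algebra.Properties.Semiring.Exp as Exp
import Algebra.Properties.Semiring.Sum as Sum
open import Data.Bool.Base using (Bool; true; false; if_then_else_; _∧_; _∨_)
open import Data.Fin.Base using (Fin; zero; suc; toℕ; fromℕ; inject₁; _<_)
open import Data.Fin.Properties using (_≟_; _<?_; any?; all?)
open import Data.Fin.Subset using (Subset; _∉_)
open import Data.List.Base as List using (List; []; _∷_; _++_; concatMap)
open import Data.List.Properties using () renaming (≡-dec to ≡-decList)
open import Data.Nat.Base using (ℕ; zero; suc; _≤_; parity)
open import Data.Parity.Base using (Parity; 0ℙ; 1ℙ)
open import Data.Product using (∃; ∃₂; ∃!; ∃-syntax; Σ-syntax; _×_; _,_; proj₁; proj₂)
open import Data.Product.Properties using () renaming (≡-dec to ≡-dec×)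
open import Data.Sum.Base using (_⊎_; inj₁; inj₂)
open import Data.Vec.Base using (Vec; lookup; count)
open import Data.Vec.Functional using (Vector)
open import Function.Base using (_on_)
open import Level using (_⊔_; 0ℓ) renaming (suc to lsuc)
open import Relation.Binary.Bundles using (Setoid)
open import Relation.Binary.Core using (Rel)
open import Relation.Binary.Definitions using (DecidableEquality)
import Relation.Binary.Construct.Closure.Equivalence as Equivalence
open import Relation.Binary.Construct.Closure.ReflexiveTransitive using (Star; ε; _◅_; _◅◅_)
import Relation.Binary.Construct.On as On
open import Relation.Binary.Construct.Union using (_∪_)
open import Relation.Binary.PropositionalEquality as ≡ using (_≡_; _≢_; refl)
open import Relation.Nullary.Decidable using (Dec; yes; no; does; map′; recompute; _×-dec_; _⊎-dec_; _→-dec_)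
open import Relation.Nullary.Negation using (¬_)
open import Relation.Unary using (Pred)

data Direction : Set where
  direct inverse : Direction

opposite : Direction → Direction
opposite direct  = inverse
opposite inverse = direct

infix 4 _≟ᴰ_ _≟ᴸ_

_≟ᴰ_ : DecidableEquality Direction
direct  ≟ᴰ direct  = yes refl
direct  ≟ᴰ inverse = no λ ()
inverse ≟ᴰ direct  = no λ ()
inverse ≟ᴰ inverse = yes refl

data Letter : Set where
  arrow loop : Direction → Letter

pattern ⟶ = arrow direct
pattern ⟵ = arrow inverse
pattern ↪ = loop direct
pattern ↩ = loop inverse

_≟ᴸ_ : DecidableEquality Letter
arrow d ≟ᴸ arrow e = map′ (λ { refl → refl }) (λ { refl → refl }) (d ≟ᴰ e)
arrow _ ≟ᴸ loop _  = no λ ()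
loop _  ≟ᴸ arrow _ = no λ ()
loop d  ≟ᴸ loop e  = map′ (λ { refl → refl }) (λ { refl → refl }) (d ≟ᴰ e)

direction : Letter → Direction
direction (arrow d) = d
direction (loop d)  = d

IsLoop : Letter → Set
IsLoop l = l ≡ loop (direction l)

isLoop? : ∀ l → Dec (IsLoop l)
isLoop? l = l ≟ᴸ loop (direction l)

module _ {m : ℕ} (u : Vec Letter m) where

  LeftLoop : Fin m → Set
  LeftLoop i = IsLoop (lookup u i) ×
    (∀ j → j < i → lookup u j ≡ arrow (opposite (direction (lookup u i))))

  RightLoop : Fin m → Set
  RightLoop i = IsLoop (lookup u i) ×
    (∀ j → i < j → lookup u j ≡ arrow (opposite (direction (lookup u i))))

  leftLoop? : ∀ i → Dec (LeftLoop i)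
  leftLoop? i = isLoop? _ ×-dec all? λ j → (j <? i) →-dec (lookup u j ≟ᴸ _)

  rightLoop? : ∀ i → Dec (RightLoop i)
  rightLoop? i = isLoop? _ ×-dec all? λ j → (i <? j) →-dec (lookup u j ≟ᴸ _)

-- The word has m letters u₁ ⋯ uₘ, hence n = m + 1 positions a₁, …, aₙ.
-- Indices are zero-based: i : Fin m is the letter u_{i+1}, standing
-- between the positions inject₁ i and suc i of Fin (suc m).
record Loopstring : Set where
  field
    m        : ℕ
    word     : Vec Letter m
    ≤2-loops : count isLoop? word ≤ 2
    notFirst : ∀ i → IsLoop (lookup word i) → inject₁ i ≢ zero
    notLast  : ∀ i → IsLoop (lookup word i) → suc i ≢ fromℕ m
    oneSided : ∀ i → IsLoop (lookup word i) → LeftLoop word i ⊎ RightLoop word i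

  n : ℕ
  n = suc m

  letter : Fin m → Letter
  letter = lookup word

-- The identity entries of M(w): one for each letter, plus an additional
-- one for each left loop and each right loop.  (A single loop letter may
-- be both a left and a right loop, and then has both additional entries.)
data Connection (w : Loopstring) : Set where
  byLetter : Fin (Loopstring.m w) → Connection w
  byLeft   : ∀ i → .(LeftLoop (Loopstring.word w) i) → Connection w
  byRight  : ∀ i → .(RightLoop (Loopstring.word w) i) → Connection w

orient : ∀ {a} {A : Set a} → Direction → A → A → A × A
orient direct  x y = x , y
orient inverse x y = y , x

module _ (w : Loopstring) where
  open Loopstring w

  endpoints : Connection w → Fin n × Fin n
  endpoints (byLetter i)  = orient (direction (letter i)) (inject₁ i) (suc i)
  endpoints (byLeft i _)  = orient (direction (letter i)) (suc i) zero
  endpoints (byRight i _) = orient (direction (letter i)) (fromℕ m) (inject₁ i)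

  start end : Connection w → Fin n
  start e = proj₁ (endpoints e)
  end   e = proj₂ (endpoints e)

  anyConnection? : ∀ {p} {P : Pred (Connection w) p} → (∀ e → Dec (P e)) → Dec (∃ P)
  anyConnection? {P = P} P? = map′ join split
    (any? (λ i → P? (byLetter i)) ⊎-dec
     any? (λ i → left? i) ⊎-dec
     any? (λ i → right? i))
    where
    left? : ∀ i → Dec (∃[ l ] P (byLeft i l))
    left? i with leftLoop? word i
    ... | yes l = map′ (l ,_) proj₂ (P? (byLeft i l))
    ... | no ¬l = no λ { (l , _) → ¬l l }
    right? : ∀ i → Dec (∃[ r ] P (byRight i r))
    right? i with rightLoop? word i
    ... | yes r = map′ (r ,_) proj₂ (P? (byRight i r))
    ... | no ¬r = no λ { (r , _) → ¬r r }
    Found : Set _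
    Found = (∃[ i ] P (byLetter i)) ⊎ (∃[ i ] ∃[ l ] P (byLeft i l))
              ⊎ (∃[ i ] ∃[ r ] P (byRight i r))
    join : Found → ∃ P
    join (inj₁ (i , p))            = byLetter i , p
    join (inj₂ (inj₁ (i , l , p))) = byLeft i l , p
    join (inj₂ (inj₂ (i , r , p))) = byRight i r , p
    split : ∃ P → Found
    split (byLetter i , p)  = inj₁ (i , p)
    split (byLeft i l , p)  = inj₂ (inj₁ (i , recompute (leftLoop? word i) l , p))
    split (byRight i r , p) = inj₂ (inj₂ (i , recompute (rightLoop? word i) r , p))

-- A graph whose vertices and edges are given up to equivalence relations.
record Graph : Set₁ where
  field
    vertices edges : Setoid 0ℓ 0ℓ
    Incident       : Setoid.Carrier edges → Setoid.Carrier vertices → Set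

  Vertex Edge : Set
  Vertex = Setoid.Carrier vertices
  Edge   = Setoid.Carrier edges

  open Setoid edges public using () renaming (_≈_ to _≈ᴱ_)

record PerfectMatching (G : Graph) : Set where
  open Graph G
  field
    member   : Edge → Bool
    respects : ∀ {e f} → e ≈ᴱ f → member e ≡ member f
    perfect  : ∀ v → ∃! _≈ᴱ_ λ e → member e ≡ true × Incident e v

data Side : Set where
  N S E W : Side

data Corner : Set where
  SW SE NW NE : Corner

-- The two end points of a side: one of the corners SW and NE …
apex : Side → Corner
apex N = NE
apex E = NE
apex S = SW
apex W = SW

-- … and one of the corners NW and SE.
otherEnd : Side → Corner
otherEnd N = NW
otherEnd W = NW
otherEnd S = SE
otherEnd E = SE

TileSide : ℕ → Set
TileSide n = Fin n × Side

TileCorner : ℕ → Set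
TileCorner n = Fin n × Corner

-- How the end points of two sides are identified when the sides are.
-- Glueing E to W or N to S in the plane matches NE with the corner of
-- the second side other than SW, and SW with the corner of the first
-- side other than NE.  The loop glueings follow the same rule by
-- definition, for pairs of sides among N, E and pairs among S, W.
data CornerGlueing {n} (R : Rel (TileSide n) 0ℓ) : Rel (TileCorner n) 0ℓ where
  apex-other : ∀ {i s j t} → R (i , s) (j , t) → CornerGlueing R (i , apex s) (j , otherEnd t)
  other-apex : ∀ {i s j t} → R (i , s) (j , t) → CornerGlueing R (i , otherEnd s) (j , apex t)

-- The quotient of n disjoint tiles by a glueing of their sides.
glue : ∀ {n} → Rel (TileSide n) 0ℓ → Graph
glue {n} R = record
  { vertices = Equivalence.setoid (CornerGlueing R)
  ; edges    = Equivalence.setoid R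
  ; Incident = λ { (i , s) v → (i , apex s) ~ v ⊎ (i , otherEnd s) ~ v }
  }
  where
  _~_ : Rel (TileCorner n) 0ℓ
  _~_ = Equivalence.EqClosure (CornerGlueing R)

data Step : Set where
  right up : Step

-- The position of the next tile; the first argument is the parity of
-- the index i in uᵢ.
nextTile : Parity → Direction → Step
nextTile 1ℙ direct  = right
nextTile 1ℙ inverse = up
nextTile 0ℙ direct  = up
nextTile 0ℙ inverse = right

-- The side along which the next tile is glued; for the last step of a
-- snake graph it is also the side of the last tile that shares no vertex
-- with the tile before it.
exit : Step → Side
exit right = E
exit up    = N

entry : Step → Side
entry right = W
entry up    = S

-- The boundary edge among the N and E sides of a tile followed by the
-- given step …
freeExit : Step → Side
freeExit right = N
freeExit up    = E

-- … and among the S and W sides of a tile reached by the given step.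
freeEntry : Step → Side
freeEntry right = S
freeEntry up    = W

module _ (w : Loopstring) where
  open Loopstring w

  step : Fin m → Step
  step i = nextTile (parity (suc (toℕ i))) (direction (letter i))

  data Adjacent : Rel (TileSide n) 0ℓ where
    adjacent : ∀ i → Adjacent (inject₁ i , exit (step i)) (suc i , entry (step i))

  data LoopGlueing : Rel (TileSide n) 0ℓ where
    rightLoop : ∀ {i l} → RightLoop word i → suc l ≡ fromℕ m →
                LoopGlueing (fromℕ m , exit (step l)) (inject₁ i , freeExit (step i))
    leftLoop  : ∀ {i f} → LeftLoop word i → inject₁ f ≡ zero →
                LoopGlueing (zero , entry (step f)) (suc i , freeEntry (step i))

  snakeGraph loopGraph : Graph
  snakeGraph = glue Adjacent
  loopGraph  = glue (Adjacent ∪ LoopGlueing)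

  -- P is obtained from the perfect matching P̂ of the snake graph by
  -- discarding, at every loop glueing, one of the two glued sides, which
  -- is required to lie in P̂.
  record _ExtendsTo_ (P : PerfectMatching loopGraph) (P̂ : PerfectMatching snakeGraph) : Set where
    open PerfectMatching
    field
      unglued : ∀ e → (∀ f → ¬ LoopGlueing e f × ¬ LoopGlueing f e) → member P e ≡ member P̂ e
      glued   : ∀ {e f} → LoopGlueing e f → member P e ≡ member P̂ e ∧ member P̂ f
      covered : ∀ {e f} → LoopGlueing e f → member P̂ e ∨ member P̂ f ≡ true

  -- The perfect matchings of a loop graph are the "good" ones, those that
  -- extend to the underlying snake graph.  Without this the loop graph of
  -- ⟶↪⟵⟵ would have 12 perfect matchings, not connected by flips, against
  -- 9 canonical submodules.
  record LoopMatching : Set where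
    field
      matching : PerfectMatching loopGraph
      good     : ∃ (matching ExtendsTo_)

    open PerfectMatching matching public

data Pair : Set where
  horizontal vertical : Pair

otherPair : Pair → Pair
otherPair horizontal = vertical
otherPair vertical   = horizontal

_∈ᴾ_ : Side → Pair → Bool
N ∈ᴾ horizontal = true
S ∈ᴾ horizontal = true
E ∈ᴾ horizontal = false
W ∈ᴾ horizontal = false
N ∈ᴾ vertical   = false
S ∈ᴾ vertical   = false
E ∈ᴾ vertical   = true
W ∈ᴾ vertical   = true

-- Increasing flips replace {E, W} by {N, S} on the tiles G₁, G₃, … and
-- {N, S} by {E, W} on G₂, G₄, …; thus the minimal matching of a snake
-- graph is the boundary matching that contains W(G₁).
lowerPair : ∀ {n} → Fin n → Pair
lowerPair i with parity (suc (toℕ i))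
... | 1ℙ = vertical
... | 0ℙ = horizontal

module _ (w : Loopstring) where
  open Loopstring w
  open LoopMatching
  open Graph (loopGraph w) using (_≈ᴱ_)

  Restricts : LoopMatching w → Fin n → Pair → Set
  Restricts P i o = ∀ s → member P (i , s) ≡ s ∈ᴾ o

  record Flip (i : Fin n) (o : Pair) (P Q : LoopMatching w) : Set where
    field
      source  : Restricts P i o
      target  : Restricts Q i (otherPair o)
      outside : ∀ e → (∀ s → ¬ (i , s) ≈ᴱ e) → member P e ≡ member Q e

  matchings : Setoid 0ℓ 0ℓ
  matchings = record
    { Carrier       = LoopMatching w
    ; _≈_           = λ P Q → ∀ e → member P e ≡ member Q e
    ; isEquivalence = record
      { refl  = λ _ → refl
      ; sym   = λ P≈Q e → ≡.sym (P≈Q e)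
      ; trans = λ P≈Q Q≈R e → ≡.trans (P≈Q e) (Q≈R e)
      }
    }

  HasseEdgeᴾ : Rel (LoopMatching w) 0ℓ
  HasseEdgeᴾ P Q = ∃₂ λ i o → Flip i o P Q

  infix 4 _≤ᴾ_

  data _≤ᴾ_ : Rel (LoopMatching w) 0ℓ where
    reflexive : ∀ {P Q} → Setoid._≈_ matchings P Q → P ≤ᴾ Q
    flip      : ∀ {P Q R} i → Flip i (lowerPair i) P Q → Q ≤ᴾ R → P ≤ᴾ R

module _ {c ℓ₁ ℓ₂} (K : HeytingField c ℓ₁ ℓ₂) where
  open HeytingField K using (Carrier; _≈_; _+_; _*_; 0#; heytingCommutativeRing)
  open CommutativeRing (HeytingCommutativeRing.commutativeRing heytingCommutativeRing)
    using (semiring)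
  open Exp semiring using (_^_)
  open Sum semiring using (sum)

  -- Every monic polynomial of positive degree has a root.
  AlgebraicallyClosed : Set (c ⊔ ℓ₁)
  AlgebraicallyClosed = ∀ d (a : Vector Carrier (suc d)) →
    ∃[ x ] x ^ suc d + sum (λ i → a i * x ^ toℕ i) ≈ 0#

record Quiver : Set where
  field
    #vertices #arrows : ℕ
    source target     : Fin #arrows → Fin #vertices

  Vertex Arrow : Set
  Vertex = Fin #vertices
  Arrow  = Fin #arrows

  Path : Rel Vertex 0ℓ
  Path = Star λ x y → ∃[ β ] source β ≡ x × target β ≡ y

  arrows : ∀ {x y} → Path x y → List Arrow
  arrows ε             = []
  arrows ((β , _) ◅ p) = β ∷ arrows p

  AnyPath : Set
  AnyPath = ∃₂ Path

  -- A path is determined by its starting point and its sequence of arrows.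
  code : AnyPath → Vertex × List Arrow
  code (x , _ , p) = x , arrows p

  samePath? : ∀ p q → Dec (code p ≡ code q)
  samePath? p q = ≡-dec× _≟_ (≡-decList _≟_) (code p) (code q)

  length : AnyPath → ℕ
  length (_ , _ , p) = List.length (arrows p)

module _ {c ℓ₁ ℓ₂} (K : HeytingField c ℓ₁ ℓ₂) (Q : Quiver) where
  open HeytingField K using (Carrier; _≈_; _+_; _*_; 0#; 1#)
  open Quiver Q

  -- Elements of the path algebra KQ, as formal linear combinations of
  -- paths; two of them are equal when they have the same coefficients.
  PathAlgebra : Set c
  PathAlgebra = List (Carrier × AnyPath)

  coefficient : PathAlgebra → AnyPath → Carrier
  coefficient []            q = 0#
  coefficient ((a , p) ∷ f) q =
    (if does (samePath? p q) then a else 0#) + coefficient f q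

  _≈ᴷ_ : Rel PathAlgebra ℓ₁
  f ≈ᴷ g = ∀ p → coefficient f p ≈ coefficient g p

  path : AnyPath → PathAlgebra
  path p = (1# , p) ∷ []

  termProduct : Carrier × AnyPath → Carrier × AnyPath → PathAlgebra
  termProduct (a , x , y , p) (b , y′ , z , q) with y ≟ y′
  ... | yes refl = (a * b , x , z , p ◅◅ q) ∷ []
  ... | no _     = []

  -- Concatenation: first the paths of f, then those of g.
  _·_ : PathAlgebra → PathAlgebra → PathAlgebra
  f · g = concatMap (λ s → concatMap (termProduct s) g) f

  record IsIdeal {ℓ} (I : Pred PathAlgebra ℓ) : Set (c ⊔ ℓ₁ ⊔ ℓ) where
    field
      respects  : ∀ {f g} → f ≈ᴷ g → I f → I g
      zero∈     : I []
      +-closed  : ∀ {f g} → I f → I g → I (f ++ g)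
      ·-closedˡ : ∀ f {g} → I g → I (f · g)
      ·-closedʳ : ∀ {f} g → I f → I (f · g)

  -- Rᵐ ⊆ I ⊆ R² for some m ≥ 2, where R is the arrow ideal.
  record IsAdmissible {ℓ} (I : Pred PathAlgebra ℓ) : Set (c ⊔ ℓ₁ ⊔ ℓ) where
    field
      isIdeal : IsIdeal I
      bounded : ∃[ m ] 2 ≤ m × (∀ p → m ≤ length p → I (path p))
      ⊆R²     : ∀ {f} → I f → ∀ p → length p ≤ 1 → coefficient f p ≈ 0#

-- The bound quiver algebra KQ/I.  Its modules are the KQ-modules
-- annihilated by I.
record BoundQuiver {c ℓ₁ ℓ₂} (K : HeytingField c ℓ₁ ℓ₂) ℓ : Set (c ⊔ ℓ₁ ⊔ lsuc ℓ) where
  field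
    quiver       : Quiver
    I            : Pred (PathAlgebra K quiver) ℓ
    isAdmissible : IsAdmissible K quiver I

-- A loopstring whose positions lie at vertices of Q and whose
-- connections are realised by arrows of Q.
record LoopstringIn (Q : Quiver) : Set where
  open Quiver Q
  field
    loopstring : Loopstring

  open Loopstring loopstring public

  field
    vertexAt     : Fin n → Vertex
    arrowOf      : Connection loopstring → Arrow
    arrow-source : ∀ e → source (arrowOf e) ≡ vertexAt (start loopstring e)
    arrow-target : ∀ e → target (arrowOf e) ≡ vertexAt (end loopstring e)

module _ {c ℓ₁ ℓ₂} (K : HeytingField c ℓ₁ ℓ₂) {Q : Quiver} (w : LoopstringIn Q) where
  open HeytingField K using (Carrier; _≈_; _+_; _*_; 0#; 1#; heytingCommutativeRing)
  open CommutativeRing (HeytingCommutativeRing.commutativeRing heytingCommutativeRing)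
    using (semiring)
  open Sum semiring using (sum)
  open Quiver Q
  open LoopstringIn w

  -- The vector space underlying M(w), with coordinates with respect to
  -- the standard basis e₁, …, eₙ.
  Space : Set c
  Space = Vector Carrier n

  infix 4 _≋_

  _≋_ : Rel Space ℓ₁
  v ≋ v′ = ∀ i → v i ≈ v′ i

  basis : Fin n → Space
  basis i j = if does (i ≟ j) then 1# else 0#

  connects? : ∀ β i j → Dec (∃[ e ] arrowOf e ≡ β × start loopstring e ≡ i × end loopstring e ≡ j)
  connects? β i j = anyConnection? loopstring λ e →
    (arrowOf e ≟ β) ×-dec (start loopstring e ≟ i) ×-dec (end loopstring e ≟ j)

  matrix : Arrow → Fin n → Fin n → Carrier
  matrix β j i = if does (connects? β i j) then 1# else 0#

  actArrow : Arrow → Space → Space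
  actArrow β v j = sum λ i → matrix β j i * v i

  -- The trivial path at x projects onto the span of the basis vectors at x.
  actPath : ∀ {x y} → Path x y → Space → Space
  actPath {x} ε         v = λ i → if does (vertexAt i ≟ x) then v i else 0#
  actPath ((β , _) ◅ p) v = actPath p (actArrow β v)

  act : PathAlgebra K Q → Space → Space
  act []                 v j = 0#
  act ((a , _ , _ , p) ∷ f) v j = a * actPath p v j + act f v j

  Annihilates : ∀ {ℓ} → Pred (PathAlgebra K Q) ℓ → Set (c ⊔ ℓ₁ ⊔ ℓ)
  Annihilates I = ∀ {f} → I f → ∀ v → act f v ≋ λ _ → 0#

  record IsSubmodule {ℓ} (U : Pred Space ℓ) : Set (c ⊔ ℓ₁ ⊔ ℓ) where
    field
      respects   : ∀ {v v′} → v ≋ v′ → U v → U v′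
      zero∈      : U (λ _ → 0#)
      +-closed   : ∀ {v v′} → U v → U v′ → U (λ i → v i + v′ i)
      *-closed   : ∀ a {v} → U v → U (λ i → a * v i)
      act-closed : ∀ f {v} → U v → U (act f v)

  Span : Subset n → Pred Space (c ⊔ ℓ₁)
  Span X v = Σ[ a ∈ Vector Carrier n ] (∀ i → i ∉ X → a i ≈ 0#) × v ≋ λ j → sum λ i → a i * basis i j

  record CanonicalSubmodule : Set (c ⊔ ℓ₁) where
    field
      support     : Subset n
      isSubmodule : IsSubmodule (Span support)

  open CanonicalSubmodule

  canonicalSubmodules : Setoid (c ⊔ ℓ₁) 0ℓ
  canonicalSubmodules = record
    { Carrier       = CanonicalSubmodule
    ; _≈_           = _≡_ on support
    ; isEquivalence = On.isEquivalence support ≡.isEquivalence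
    }

  infix 4 _≤ᴹ_

  _≤ᴹ_ : Rel CanonicalSubmodule (c ⊔ ℓ₁)
  U ≤ᴹ V = ∀ v → Span (support U) v → Span (support V) v

  HasseEdgeᴹ : Rel CanonicalSubmodule 0ℓ
  HasseEdgeᴹ U V = ∃! _≡_ λ i → lookup (support U) i ≢ lookup (support V) i

record LoopstringOver {c ℓ₁ ℓ₂ ℓ} {K : HeytingField c ℓ₁ ℓ₂} (A : BoundQuiver K ℓ) : Set (c ⊔ ℓ₁ ⊔ ℓ) where
  open BoundQuiver A
  field
    realisation : LoopstringIn quiver
    isModule    : Annihilates K realisation I

  open LoopstringIn realisation public using (loopstring)

{-# OPTIONS --safe #-}
module Submission where

-- Think of the loop graph as n separate tiles whose sides are glued in
-- pairs.  Every tile has two matchings, a lower one and an upper one, and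
-- when a side e is glued to a side f, matchings of the tiles descend to the
-- quotient precisely when e or f is matched; the glued edge is then matched
-- if and only if both are.  Conversely, the tiles of a snake graph can be
-- cut off one at a time, because a cut off tile has an even number of
-- vertices, and good matchings of the loop graph come from the snake graph.
-- So good matchings correspond to sets X ⊆ {1, …, n} (the tiles in their
-- upper state) subject to one condition per glueing.  With the chosen lower
-- matchings, the condition for the glueing attached to an arrow from e_i to
-- e_j reads "i ∈ X implies j ∈ X", so the sets X are the supports of the
-- canonical submodules.  A flip adds or removes one element of X.  Finally,
-- as M(w) has no oriented cycles, any two nested supports are connected by a
-- chain in which each term has one element more than the previous one.

open import Defs
open import Algebra.Apartness.Bundles using (HeytingField; HeytingCommutativeRing)
open import Algebra.Bundles using (CommutativeRing)
import Algebra.Properties.Semiring.Sum as Sum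
open import Data.Bool.Base using (Bool; true; false; if_then_else_; _∧_; _∨_; not; _xor_)
open import Data.Bool.Properties using (∧-comm; ∧-identityʳ; ∨-comm; ∨-zeroʳ; not-involutive; not-¬; ¬-not) renaming (_≟_ to _≟ᵇ_)
open import Data.Fin.Base as Fin using (Fin; zero; suc; toℕ; fromℕ; inject₁; punchIn)
open import Data.Fin.Induction using (>-weakInduction)
open import Data.Fin.Properties using (_≟_; any?; suc-injective; inject₁-injective; fromℕ≢inject₁; toℕ-inject₁; <-cmp; <-irrefl; ≤fromℕ; ≤∧≢⇒<; punchInᵢ≢i)
open import Data.Fin.Subset using (Subset; _⊃_; _∉_)
open import Data.Fin.Subset.Induction using (⊃-wellFounded)
open import Data.List.Base using (List; []; _∷_; foldr; map; allFin)
open import Data.List.Membership.Propositional using (_∈_)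
open import Data.List.Membership.Propositional.Properties using (∈-map⁺; ∈-map⁻; ∈-allFin)
open import Data.List.Relation.Unary.All as All using (All)
open import Data.List.Relation.Unary.AllPairs using (AllPairs; []; _∷_)
open import Data.List.Relation.Unary.AllPairs.Properties using (tabulate⁺-<)
open import Data.List.Relation.Unary.Any using (here; there)
open import Data.Nat.Base as ℕ using (ℕ; parity; _+_)
open import Data.Nat.Induction using (<-wellFounded)
import Data.Nat.Properties as ℕ
open import Data.Parity.Base using (Parity; 0ℙ; 1ℙ; _⁻¹)
open import Data.Parity.Properties using (suc-homo-⁻¹; ⁻¹-selfInverse)
open import Data.Product.Base using (Σ; ∃; _×_; _,_; proj₁; proj₂; map₂)
open import Data.Product.Properties using (≡-dec)
open import Data.Sum.Base using (_⊎_; inj₁; inj₂; [_,_]′; swap) renaming (map to map⊎)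
open import Data.Vec.Base as Vec using (Vec; []; _∷_; lookup; tabulate; _[_]≔_)
open import Data.Vec.Functional using (Vector; updateAt; removeAt)
open import Data.Vec.Functional.Properties using (updateAt-updates; updateAt-minimal)
open import Data.Vec.Properties using (lookup∘tabulate; tabulate∘lookup; tabulate-cong; lookup∘update; lookup∘update′; []=⇒lookup; lookup⇒[]=)
open import Function.Base using (_∘_; case_of_; id)
open import Function.Bundles using (Bijection; _⇔_; mk⇔)
open import Induction.WellFounded using (Acc; acc)
open import Level using (0ℓ)
open import Relation.Binary.Construct.Closure.Equivalence as EqClosure using (EqClosure; gfold)
open import Relation.Binary.Construct.Closure.ReflexiveTransitive using (ε; _◅_; _◅◅_)
open import Relation.Binary.Construct.Closure.Symmetric using (fwd; bwd)
open import Relation.Binary.Construct.Union using (_∪_)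
open import Relation.Binary.Core using (Rel)
open import Relation.Binary.Definitions using (DecidableEquality; tri<; tri≈; tri>)
open import Relation.Binary.PropositionalEquality using (_≡_; _≢_; refl; sym; trans; cong; cong₂; subst; subst₂; isEquivalence)
open import Relation.Nullary.Decidable using (Dec; yes; no; does; dec-true; dec-false; recompute; decidable-stable; _⊎-dec_; _×-dec_)
open import Relation.Nullary.Negation using (¬_; contradiction)

-- Glueing and cutting are not symmetric. Once a loop is closed, none of its tiles hangs on a single
-- side any more, and the loop graph may have matchings that come from no tile states. Hence glueing
-- is proved for any attachable pair of sides, cutting only for the snake, and it is the snake
-- matching supplied by `good` that gets cut.
--
-- Planar and loop glueings obey the same corner rule, `apex` to `otherEnd`, so one glueing argument
-- serves both; they differ only in why the pair is attachable. The delicate condition is that the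
-- two ends of the second side have not been merged before, for which the snake is two-coloured.
--
-- Vertices and edges are classes of generated equivalences. A perfect matching is therefore handled
-- as a choice of partner edge at every corner, and the classes are controlled by maps that respect
-- the generators (colours, retractions).
--
-- The glued matching records only conjunctions of tile states. These determine the states because
-- the last tile has a side that is never glued, from which the states are recovered backwards along
-- the snake.

closure-invariant : ∀ {A B : Set} {R : Rel A 0ℓ} (φ : A → B) →
                    (∀ {x y} → R x y → φ x ≡ φ y) →
                    ∀ {x y} → EqClosure R x y → φ x ≡ φ y
closure-invariant = gfold isEquivalence

-- A class can leave `a` only through a generator that has `a` as one of its two terms.
isolated : ∀ {A : Set} {R : Rel A 0ℓ} {a : A} →
           (∀ {x y} → R x y → x ≢ a × y ≢ a) →
           ∀ {y} → EqClosure R a y → y ≡ a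
isolated h ε           = refl
isolated h (fwd r ◅ _) = contradiction refl (proj₁ (h r))
isolated h (bwd r ◅ _) = contradiction refl (proj₂ (h r))

-- Sides and corners of a square tile

infix 4 _≟ˢ_ _≟ᶜ_ _≟ᵀˢ_ _≟ᵀᶜ_

_≟ˢ_ : DecidableEquality Side
N ≟ˢ N = yes refl
N ≟ˢ S = no λ ()
N ≟ˢ E = no λ ()
N ≟ˢ W = no λ ()
S ≟ˢ N = no λ ()
S ≟ˢ S = yes refl
S ≟ˢ E = no λ ()
S ≟ˢ W = no λ ()
E ≟ˢ N = no λ ()
E ≟ˢ S = no λ ()
E ≟ˢ E = yes refl
E ≟ˢ W = no λ ()
W ≟ˢ N = no λ ()
W ≟ˢ S = no λ ()
W ≟ˢ E = no λ ()
W ≟ˢ W = yes refl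

_≟ᶜ_ : DecidableEquality Corner
SW ≟ᶜ SW = yes refl
SW ≟ᶜ SE = no λ ()
SW ≟ᶜ NW = no λ ()
SW ≟ᶜ NE = no λ ()
SE ≟ᶜ SW = no λ ()
SE ≟ᶜ SE = yes refl
SE ≟ᶜ NW = no λ ()
SE ≟ᶜ NE = no λ ()
NW ≟ᶜ SW = no λ ()
NW ≟ᶜ SE = no λ ()
NW ≟ᶜ NW = yes refl
NW ≟ᶜ NE = no λ ()
NE ≟ᶜ SW = no λ ()
NE ≟ᶜ SE = no λ ()
NE ≟ᶜ NW = no λ ()
NE ≟ᶜ NE = yes refl

_≟ᵀˢ_ : ∀ {n} → DecidableEquality (TileSide n)
_≟ᵀˢ_ = ≡-dec _≟_ _≟ˢ_

_≟ᵀᶜ_ : ∀ {n} → DecidableEquality (TileCorner n)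
_≟ᵀᶜ_ = ≡-dec _≟_ _≟ᶜ_

apexOf otherOf : ∀ {n} → TileSide n → TileCorner n
apexOf  (i , s) = i , apex s
otherOf (i , s) = i , otherEnd s

IsEnd : ∀ {n} → TileSide n → TileCorner n → Set
IsEnd e κ = κ ≡ apexOf e ⊎ κ ≡ otherOf e

apex≢otherEnd : ∀ s → apex s ≢ otherEnd s
apex≢otherEnd N ()
apex≢otherEnd S ()
apex≢otherEnd E ()
apex≢otherEnd W ()

oppositeSide apexNeighbour otherNeighbour : Side → Side
oppositeSide N = S
oppositeSide S = N
oppositeSide E = W
oppositeSide W = E
apexNeighbour N = E
apexNeighbour E = N
apexNeighbour S = W
apexNeighbour W = S
otherNeighbour N = W
otherNeighbour W = N
otherNeighbour S = E
otherNeighbour E = S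

pairOf : Side → Pair
pairOf N = horizontal
pairOf S = horizontal
pairOf E = vertical
pairOf W = vertical

sideAt : Pair → Corner → Side
sideAt horizontal SW = S
sideAt horizontal SE = S
sideAt horizontal NW = N
sideAt horizontal NE = N
sideAt vertical   SW = W
sideAt vertical   NW = W
sideAt vertical   SE = E
sideAt vertical   NE = E

-- The sides of a tile as seen from `s`: an argument about a tile glued along `s` then needs no
-- repetition for the four orientations.
data Relative (s : Side) : Side → Set where
  itself   : Relative s s
  across   : Relative s (oppositeSide s)
  atApex   : Relative s (apexNeighbour s)
  atOther  : Relative s (otherNeighbour s)

relative : ∀ s t → Relative s t
relative N N = itself
relative N S = across
relative N E = atApex
relative N W = atOther
relative S N = across
relative S S = itself
relative S E = atOther
relative S W = atApex
relative E N = atApex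
relative E S = atOther
relative E E = itself
relative E W = across
relative W N = atOther
relative W S = atApex
relative W E = across
relative W W = itself

sideAt-∈ᴾ : ∀ o c → sideAt o c ∈ᴾ o ≡ true
sideAt-∈ᴾ horizontal SW = refl
sideAt-∈ᴾ horizontal SE = refl
sideAt-∈ᴾ horizontal NW = refl
sideAt-∈ᴾ horizontal NE = refl
sideAt-∈ᴾ vertical   SW = refl
sideAt-∈ᴾ vertical   SE = refl
sideAt-∈ᴾ vertical   NW = refl
sideAt-∈ᴾ vertical   NE = refl

sideAt-end : ∀ o c → apex (sideAt o c) ≡ c ⊎ otherEnd (sideAt o c) ≡ c
sideAt-end horizontal SW = inj₁ refl
sideAt-end horizontal SE = inj₂ refl
sideAt-end horizontal NW = inj₂ refl
sideAt-end horizontal NE = inj₁ refl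
sideAt-end vertical   SW = inj₁ refl
sideAt-end vertical   SE = inj₂ refl
sideAt-end vertical   NW = inj₂ refl
sideAt-end vertical   NE = inj₁ refl

sideAt-apex : ∀ t o → t ∈ᴾ o ≡ true → sideAt o (apex t) ≡ t
sideAt-apex N horizontal _ = refl
sideAt-apex S horizontal _ = refl
sideAt-apex E vertical   _ = refl
sideAt-apex W vertical   _ = refl

sideAt-otherEnd : ∀ t o → t ∈ᴾ o ≡ true → sideAt o (otherEnd t) ≡ t
sideAt-otherEnd N horizontal _ = refl
sideAt-otherEnd S horizontal _ = refl
sideAt-otherEnd E vertical   _ = refl
sideAt-otherEnd W vertical   _ = refl

oppositeSide≢ : ∀ s → oppositeSide s ≢ s
oppositeSide≢ N ()
oppositeSide≢ S ()
oppositeSide≢ E ()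
oppositeSide≢ W ()

apexNeighbour≢ : ∀ s → apexNeighbour s ≢ s × apexNeighbour s ≢ oppositeSide s
apexNeighbour≢ N = (λ ()) , λ ()
apexNeighbour≢ S = (λ ()) , λ ()
apexNeighbour≢ E = (λ ()) , λ ()
apexNeighbour≢ W = (λ ()) , λ ()

otherNeighbour≢ : ∀ s → otherNeighbour s ≢ s × otherNeighbour s ≢ oppositeSide s
otherNeighbour≢ N = (λ ()) , λ ()
otherNeighbour≢ S = (λ ()) , λ ()
otherNeighbour≢ E = (λ ()) , λ ()
otherNeighbour≢ W = (λ ()) , λ ()

apexNeighbour-ends : ∀ s → apex s ≡ apex (apexNeighbour s) ×
                           otherEnd (oppositeSide s) ≡ otherEnd (apexNeighbour s)
apexNeighbour-ends N = refl , refl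
apexNeighbour-ends S = refl , refl
apexNeighbour-ends E = refl , refl
apexNeighbour-ends W = refl , refl

otherNeighbour-ends : ∀ s → apex (oppositeSide s) ≡ apex (otherNeighbour s) ×
                            otherEnd s ≡ otherEnd (otherNeighbour s)
otherNeighbour-ends N = refl , refl
otherNeighbour-ends S = refl , refl
otherNeighbour-ends E = refl , refl
otherNeighbour-ends W = refl , refl

apex-oppositeSide : ∀ s → apex (oppositeSide s) ≢ apex s × apex (oppositeSide s) ≢ otherEnd s
apex-oppositeSide N = (λ ()) , λ ()
apex-oppositeSide S = (λ ()) , λ ()
apex-oppositeSide E = (λ ()) , λ ()
apex-oppositeSide W = (λ ()) , λ ()

otherEnd-oppositeSide : ∀ s → otherEnd (oppositeSide s) ≢ apex s × otherEnd (oppositeSide s) ≢ otherEnd s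
otherEnd-oppositeSide N = (λ ()) , λ ()
otherEnd-oppositeSide S = (λ ()) , λ ()
otherEnd-oppositeSide E = (λ ()) , λ ()
otherEnd-oppositeSide W = (λ ()) , λ ()

∈ᴾ-pairOf : ∀ s → s ∈ᴾ pairOf s ≡ true × oppositeSide s ∈ᴾ pairOf s ≡ true ×
                  apexNeighbour s ∈ᴾ pairOf s ≡ false × otherNeighbour s ∈ᴾ pairOf s ≡ false
∈ᴾ-pairOf N = refl , refl , refl , refl
∈ᴾ-pairOf S = refl , refl , refl , refl
∈ᴾ-pairOf E = refl , refl , refl , refl
∈ᴾ-pairOf W = refl , refl , refl , refl

∈ᴾ-otherPair : ∀ s o → s ∈ᴾ otherPair o ≡ not (s ∈ᴾ o)
∈ᴾ-otherPair N horizontal = refl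
∈ᴾ-otherPair S horizontal = refl
∈ᴾ-otherPair E horizontal = refl
∈ᴾ-otherPair W horizontal = refl
∈ᴾ-otherPair N vertical = refl
∈ᴾ-otherPair S vertical = refl
∈ᴾ-otherPair E vertical = refl
∈ᴾ-otherPair W vertical = refl

-- Perfect matchings through the partner of each vertex

module _ {n} {R : Rel (TileSide n) 0ℓ} (P : PerfectMatching (glue R)) where
  open PerfectMatching P
  open Graph (glue R) using (_≈ᴱ_; Incident)

  unique : ∀ {v e f} → member e ≡ true → Incident e v →
           member f ≡ true → Incident f v → e ≈ᴱ f
  unique {v} me ie mf if =
    EqClosure.symmetric R (proj₂ (proj₂ (perfect v)) (me , ie)) ◅◅ proj₂ (proj₂ (perfect v)) (mf , if)

  partnerAt : TileCorner n → TileSide n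
  partnerAt v = proj₁ (perfect v)

  partnerAt-member : ∀ v → member (partnerAt v) ≡ true
  partnerAt-member v = proj₁ (proj₁ (proj₂ (perfect v)))

  partnerAt-incident : ∀ v → Incident (partnerAt v) v
  partnerAt-incident v = proj₂ (proj₁ (proj₂ (perfect v)))

  partnerAt-resp : ∀ {u v} → EqClosure (CornerGlueing R) u v → partnerAt u ≈ᴱ partnerAt v
  partnerAt-resp {u} {v} u~v = unique (partnerAt-member u)
    ([ (λ p → inj₁ (p ◅◅ u~v)) , (λ p → inj₂ (p ◅◅ u~v)) ]′ (partnerAt-incident u))
    (partnerAt-member v) (partnerAt-incident v)

  partnerAt-forced : ∀ {e v} → member e ≡ true → IsEnd e v → partnerAt v ≈ᴱ e
  partnerAt-forced {e} {v} me end = unique (partnerAt-member v) (partnerAt-incident v) me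
    ([ (λ { refl → inj₁ ε }) , (λ { refl → inj₂ ε }) ]′ end)

-- A perfect matching is the same thing as a choice, locally constant
-- under the corner glueing, of the matched edge at every corner.
fromChoice : ∀ {n} {R : Rel (TileSide n) 0ℓ} →
             let open Graph (glue R) in
             (member : TileSide n → Bool) →
             (∀ {e f} → R e f → member e ≡ member f) →
             (choice : TileCorner n → TileSide n) →
             (∀ v → member (choice v) ≡ true) →
             (∀ v → Incident (choice v) v) →
             (∀ {u v} → CornerGlueing R u v → choice u ≈ᴱ choice v) →
             (∀ {e v} → member e ≡ true → IsEnd e v → choice v ≈ᴱ e) →
             PerfectMatching (glue R)
fromChoice {R = R} member resp choice chosen incident coherent forced = record
  { member   = member
  ; respects = closure-invariant member resp
  ; perfect  = λ v → choice v , (chosen v , incident v) , λ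
      -- Incidence holds only up to the corner glueing: coherence moves the choice from `v` to a
      -- literal end of the edge, where `forced` applies.
      { (me , inj₁ p) → EqClosure.symmetric R (coherent* p) ◅◅ forced me (inj₁ refl)
      ; (me , inj₂ p) → EqClosure.symmetric R (coherent* p) ◅◅ forced me (inj₂ refl) }
  }
  where
  coherent* : ∀ {u v} → EqClosure (CornerGlueing R) u v → EqClosure R (choice u) (choice v)
  coherent* = gfold (EqClosure.isEquivalence R) choice coherent

-- Glueing and cutting along a single edge

Glueing : ℕ → Set
Glueing n = List (TileSide n × TileSide n)

⟦_⟧ : ∀ {n} → Glueing n → Rel (TileSide n) 0ℓ
⟦ L ⟧ e f = (e , f) ∈ L

-- If just one of the two sides is matched, the ends of the glued edge are already covered by other
-- edges at the unmatched side, so the edge has to be dropped.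
join : ∀ {n} → TileSide n × TileSide n → (TileSide n → Bool) → TileSide n → Bool
join (e , f) b g = if does ((g ≟ᵀˢ e) ⊎-dec (g ≟ᵀˢ f)) then b e ∧ b f else b g

module _ {n} {e f : TileSide n} (b : TileSide n → Bool) where

  join-glued : ∀ {g} → g ≡ e ⊎ g ≡ f → join (e , f) b g ≡ b e ∧ b f
  join-glued {g} p rewrite dec-true ((g ≟ᵀˢ e) ⊎-dec (g ≟ᵀˢ f)) p = refl

  join-free : ∀ {g} → g ≢ e → g ≢ f → join (e , f) b g ≡ b g
  join-free {g} p q rewrite dec-false ((g ≟ᵀˢ e) ⊎-dec (g ≟ᵀˢ f)) [ p , q ]′ = refl

-- The corners of e are not glued to anything yet, so that glueing e to f
-- identifies two pairs of distinct vertices.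
record Attachable {n} (L : Glueing n) (e f : TileSide n) : Set where
  field
    privateEnds : ∀ {u v x} → CornerGlueing ⟦ L ⟧ u v → IsEnd e x → u ≢ x × v ≢ x
    fresh       : ∀ {g h} → (g , h) ∈ L → g ≢ f × h ≢ f
    disjoint    : ∀ {x} → IsEnd e x → ¬ IsEnd f x
    separate    : ¬ EqClosure (CornerGlueing ⟦ L ⟧) (apexOf f) (otherOf f)

module Attach {n} {L : Glueing n} {e f : TileSide n} (A : Attachable L e f) where
  open Attachable A

  infix 4 _~_ _~′_ _≈_ _≈′_

  _~_ _~′_ : Rel (TileCorner n) 0ℓ
  _~_  = EqClosure (CornerGlueing ⟦ L ⟧)
  _~′_ = EqClosure (CornerGlueing ⟦ (e , f) ∷ L ⟧)

  _≈_ _≈′_ : Rel (TileSide n) 0ℓ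
  _≈_  = EqClosure ⟦ L ⟧
  _≈′_ = EqClosure ⟦ (e , f) ∷ L ⟧

  weaken~ : ∀ {u v} → u ~ v → u ~′ v
  weaken~ = EqClosure.map λ { (apex-other r) → apex-other (there r) ; (other-apex r) → other-apex (there r) }

  weaken≈ : ∀ {g h} → g ≈ h → g ≈′ h
  weaken≈ = EqClosure.map there

  freshᵉ : ∀ {g h} → (g , h) ∈ L → g ≢ e × h ≢ e
  freshᵉ r = (λ { refl → proj₁ (privateEnds (apex-other r) (inj₁ refl)) refl })
           , (λ { refl → proj₂ (privateEnds (apex-other r) (inj₂ refl)) refl })

  e≢f : e ≢ f
  e≢f refl = disjoint (inj₁ refl) (inj₁ refl)

  ≈e : ∀ {g} → g ≈ e → g ≡ e
  ≈e p = isolated freshᵉ (EqClosure.symmetric _ p)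

  ≈f : ∀ {g} → g ≈ f → g ≡ f
  ≈f p = isolated fresh (EqClosure.symmetric _ p)

  ~end : ∀ {u x} → IsEnd e x → u ~ x → u ≡ x
  ~end x∈e p = isolated (λ c → privateEnds c x∈e) (EqClosure.symmetric _ p)

  end? : ∀ κ → Dec (IsEnd e κ)
  end? κ = (κ ≟ᵀᶜ apexOf e) ⊎-dec (κ ≟ᵀᶜ otherOf e)

  opposite-end : ∀ {κ} → IsEnd e κ → TileCorner n
  opposite-end (inj₁ _) = otherOf f
  opposite-end (inj₂ _) = apexOf f

  -- Collapses e onto f: a retraction of the new graph onto the old one.
  ρ : TileCorner n → TileCorner n
  ρ κ with end? κ
  ... | yes p = opposite-end p
  ... | no _  = κ

  ρ-apex : ρ (apexOf e) ≡ otherOf f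
  ρ-apex with end? (apexOf e)
  ... | yes (inj₁ _) = refl
  ... | yes (inj₂ p) = contradiction (cong proj₂ p) (apex≢otherEnd (proj₂ e))
  ... | no ¬p        = contradiction (inj₁ refl) ¬p

  ρ-other : ρ (otherOf e) ≡ apexOf f
  ρ-other with end? (otherOf e)
  ... | yes (inj₁ p) = contradiction (sym (cong proj₂ p)) (apex≢otherEnd (proj₂ e))
  ... | yes (inj₂ _) = refl
  ... | no ¬p        = contradiction (inj₂ refl) ¬p

  ρ-id : ∀ {κ} → ¬ IsEnd e κ → ρ κ ≡ κ
  ρ-id {κ} ¬p with end? κ
  ... | yes p = contradiction p ¬p
  ... | no _  = refl

  ρ-f : ∀ {κ} → IsEnd f κ → ρ κ ≡ κ
  ρ-f p = ρ-id λ q → disjoint q p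

  ρ-notEnd : ∀ κ → ¬ IsEnd e (ρ κ)
  ρ-notEnd κ with end? κ
  ... | yes (inj₁ _) = λ q → disjoint q (inj₂ refl)
  ... | yes (inj₂ _) = λ q → disjoint q (inj₁ refl)
  ... | no ¬p        = ¬p

  ρ-old : ∀ {u v} → CornerGlueing ⟦ L ⟧ u v → ρ u ~ ρ v
  ρ-old c = subst₂ _~_ (sym (ρ-id (λ p → proj₁ (privateEnds c p) refl)))
                       (sym (ρ-id (λ p → proj₂ (privateEnds c p) refl)))
                       (EqClosure.return c)

  ρ-step : ∀ {u v} → CornerGlueing ⟦ (e , f) ∷ L ⟧ u v → ρ u ~ ρ v
  ρ-step (apex-other (here refl)) rewrite ρ-apex  | ρ-f (inj₂ refl) = ε
  ρ-step (other-apex (here refl)) rewrite ρ-other | ρ-f (inj₁ refl) = ε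
  ρ-step (apex-other (there r)) = ρ-old (apex-other r)
  ρ-step (other-apex (there r)) = ρ-old (other-apex r)

  ρ-cong : ∀ {u v} → u ~′ v → ρ u ~ ρ v
  ρ-cong = gfold (EqClosure.isEquivalence _) ρ ρ-step

  ρ-self : ∀ κ → ρ κ ~′ κ
  ρ-self κ with end? κ
  ... | yes (inj₁ refl) = EqClosure.symmetric _ (EqClosure.return (apex-other (here refl)))
  ... | yes (inj₂ refl) = EqClosure.symmetric _ (EqClosure.return (other-apex (here refl)))
  ... | no _            = ε

  e≈′f : e ≈′ f
  e≈′f = EqClosure.return (here refl)

  module Glue (P : PerfectMatching (glue ⟦ L ⟧)) where
    open PerfectMatching P
    open Graph (glue ⟦ L ⟧) using (Incident)
    open Graph (glue ⟦ (e , f) ∷ L ⟧) using () renaming (Incident to Incident′)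

    member′ : TileSide n → Bool
    member′ = join (e , f) member

    respects′ : ∀ {g h} → (g , h) ∈ ((e , f) ∷ L) → member′ g ≡ member′ h
    respects′ (here refl) = trans (join-glued member (inj₁ refl)) (sym (join-glued member (inj₂ refl)))
    respects′ (there r)   = trans (join-free member (proj₁ (freshᵉ r)) (proj₁ (fresh r)))
                           (trans (respects (EqClosure.return r))
                                  (sym (join-free member (proj₂ (freshᵉ r)) (proj₂ (fresh r)))))

    F : TileCorner n → TileSide n
    F = partnerAt P

    Incident-e : ∀ {κ} → Incident e κ → IsEnd e κ
    Incident-e (inj₁ p) = inj₁ (~end (inj₁ refl) (EqClosure.symmetric _ p))
    Incident-e (inj₂ p) = inj₂ (~end (inj₂ refl) (EqClosure.symmetric _ p))

    F≢e : ∀ {κ} → ¬ IsEnd e κ → F κ ≢ e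
    F≢e {κ} ¬end eq = ¬end (Incident-e (subst (λ g → Incident g κ) eq (partnerAt-incident P κ)))

    weaken-incident : ∀ {g u v} → Incident g u → u ~′ v → Incident′ g v
    weaken-incident (inj₁ p) q = inj₁ (weaken~ p ◅◅ q)
    weaken-incident (inj₂ p) q = inj₂ (weaken~ p ◅◅ q)

    free-member : ∀ {g} → g ≢ e → g ≢ f → member g ≡ true → member′ g ≡ true
    free-member p q m = trans (join-free member p q) m

    free-member⁻ : ∀ {g} → g ≢ e → g ≢ f → member′ g ≡ true → member g ≡ true
    free-member⁻ p q m = trans (sym (join-free member p q)) m

    member′-e : ∀ {g} → g ≡ e ⊎ g ≡ f → member e ∧ member f ≡ false → member′ g ≢ true
    member′-e p q m = case trans (sym (trans (join-glued member p) q)) m of λ ()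

    forcedᵉ : ∀ {g κ} → member e ≡ true → member g ≡ true → IsEnd g κ → g ≢ e → ¬ IsEnd e κ
    forcedᵉ me mg end g≢e p = g≢e (≈e (EqClosure.symmetric _ (partnerAt-forced P mg end) ◅◅ partnerAt-forced P me p))

    -- Identified corners are covered by `e` on one side and by `f` on the other. These become one
    -- edge, so every corner keeps its partner.
    bothMatched : member e ≡ true → member f ≡ true → PerfectMatching (glue ⟦ (e , f) ∷ L ⟧)
    bothMatched me mf = fromChoice member′ respects′ F
      (λ v → rise (partnerAt-member P v))
      (λ v → weaken-incident (partnerAt-incident P v) ε)
      coherent
      (λ m end → weaken≈ (partnerAt-forced P (fall m) end))
      where
      rise : ∀ {g} → member g ≡ true → member′ g ≡ true
      rise {g} m with g ≟ᵀˢ e | g ≟ᵀˢ f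
      ... | yes _ | _     = cong₂ _∧_ me mf
      ... | no _  | yes _ = cong₂ _∧_ me mf
      ... | no _  | no _  = m
      fall : ∀ {g} → member′ g ≡ true → member g ≡ true
      fall {g} m with g ≟ᵀˢ e | g ≟ᵀˢ f
      ... | yes refl | _        = me
      ... | no _     | yes refl = mf
      ... | no _     | no _     = m
      new : ∀ {u v} → IsEnd e u → IsEnd f v → F u ≈′ F v
      new p q = weaken≈ (partnerAt-forced P me p) ◅◅ e≈′f
                  ◅◅ EqClosure.symmetric _ (weaken≈ (partnerAt-forced P mf q))
      coherent : ∀ {u v} → CornerGlueing ⟦ (e , f) ∷ L ⟧ u v → F u ≈′ F v
      coherent (apex-other (here refl)) = new (inj₁ refl) (inj₂ refl)
      coherent (other-apex (here refl)) = new (inj₂ refl) (inj₁ refl)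
      coherent (apex-other (there r))   = weaken≈ (partnerAt-resp P (EqClosure.return (apex-other r)))
      coherent (other-apex (there r))   = weaken≈ (partnerAt-resp P (EqClosure.return (other-apex r)))

    -- The two corners of e become those of f, where f is not matched.
    onlyE : member e ≡ true → member f ≡ false → PerfectMatching (glue ⟦ (e , f) ∷ L ⟧)
    onlyE me ¬mf = fromChoice member′ respects′ (F ∘ ρ)
      (λ v → free-member (F≢e (ρ-notEnd v)) (F≢f (ρ v)) (partnerAt-member P (ρ v)))
      (λ v → weaken-incident (partnerAt-incident P (ρ v)) (ρ-self v))
      (λ c → weaken≈ (partnerAt-resp P (ρ-step c)))
      forced
      where
      me∧mf : member e ∧ member f ≡ false
      me∧mf = cong₂ _∧_ me ¬mf
      F≢f : ∀ v → F v ≢ f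
      F≢f v eq = case trans (sym ¬mf) (subst (λ g → member g ≡ true) eq (partnerAt-member P v)) of λ ()
      forced : ∀ {g v} → member′ g ≡ true → IsEnd g v → F (ρ v) ≈′ g
      forced {g} {v} m end = subst (λ u → F u ≈′ g) (sym (ρ-id (forcedᵉ me mg end g≢e)))
                                   (weaken≈ (partnerAt-forced P mg end))
        where
        g≢e = λ p → member′-e (inj₁ p) me∧mf m
        g≢f = λ p → member′-e (inj₂ p) me∧mf m
        mg  = free-member⁻ g≢e g≢f m

    -- A vertex matched by f is now matched by the edge that was matched
    -- at the corresponding corner of e.
    onlyF : member e ≡ false → member f ≡ true → PerfectMatching (glue ⟦ (e , f) ∷ L ⟧)
    onlyF ¬me mf = fromChoice member′ respects′ choice
      (λ v → chosen (partnerAt-member P (ρ v)) (partnerAt-incident P (ρ v)))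
      (λ v → incident (partnerAt-incident P (ρ v)) (ρ-self v))
      (λ {u} {v} c → coherent (partnerAt-resp P (ρ-step c)) (ρ-step c)
                              (partnerAt-incident P (ρ u)) (partnerAt-incident P (ρ v)))
      forced
      where
      me∧mf : member e ∧ member f ≡ false
      me∧mf = cong₂ _∧_ ¬me mf
      ≢e : ∀ {g} → member g ≡ true → g ≢ e
      ≢e m refl = case trans (sym ¬me) m of λ ()
      -- The end of `f` named by the incidence proof decides which end of `e` supplies the new edge.
      -- This is well defined because `separate` keeps the two ends of `f` distinct.
      redirect : ∀ {v} g → Incident g v → TileSide n
      redirect g inc with g ≟ᵀˢ f
      redirect g inc      | no _  = g
      redirect g (inj₁ _) | yes _ = F (otherOf e)
      redirect g (inj₂ _) | yes _ = F (apexOf e)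
      choice : TileCorner n → TileSide n
      choice v = redirect (F (ρ v)) (partnerAt-incident P (ρ v))
      F-end≢f : ∀ {x} → IsEnd e x → F x ≢ f
      F-end≢f {x} p eq with subst (λ g → Incident g x) eq (partnerAt-incident P x)
      ... | inj₁ q = disjoint (subst (IsEnd e) (sym (~end p q)) p) (inj₁ refl)
      ... | inj₂ q = disjoint (subst (IsEnd e) (sym (~end p q)) p) (inj₂ refl)
      chosen-end : ∀ {x} → IsEnd e x → member′ (F x) ≡ true
      chosen-end {x} p = free-member (≢e (partnerAt-member P x)) (F-end≢f p) (partnerAt-member P x)
      chosen : ∀ {g v} → member g ≡ true → (inc : Incident g v) → member′ (redirect g inc) ≡ true
      chosen {g} m inc with g ≟ᵀˢ f
      chosen m inc      | no ¬p = free-member (≢e m) ¬p m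
      chosen m (inj₁ _) | yes _ = chosen-end (inj₂ refl)
      chosen m (inj₂ _) | yes _ = chosen-end (inj₁ refl)
      incident : ∀ {g u v} (inc : Incident g u) → u ~′ v → Incident′ (redirect g inc) v
      incident {g} inc q with g ≟ᵀˢ f
      incident inc q | no _ = weaken-incident inc q
      incident (inj₁ p) q | yes refl = weaken-incident (partnerAt-incident P (otherOf e))
        (EqClosure.return (other-apex (here refl)) ◅◅ weaken~ p ◅◅ q)
      incident (inj₂ p) q | yes refl = weaken-incident (partnerAt-incident P (apexOf e))
        (EqClosure.return (apex-other (here refl)) ◅◅ weaken~ p ◅◅ q)
      coherent : ∀ {g h u v} → g ≈ h → u ~ v → (i : Incident g u) (j : Incident h v) →
                 redirect g i ≈′ redirect h j
      coherent {g} {h} g≈h u~v i j with g ≟ᵀˢ f | h ≟ᵀˢ f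
      coherent g≈h u~v i j | no _  | no _  = weaken≈ g≈h
      coherent g≈h u~v i j | no ¬p | yes refl = contradiction (≈f g≈h) ¬p
      coherent g≈h u~v i j | yes refl | no ¬p = contradiction (≈f (EqClosure.symmetric _ g≈h)) ¬p
      coherent g≈h u~v (inj₁ p) (inj₁ q) | yes _    | yes _    = ε
      coherent g≈h u~v (inj₂ p) (inj₂ q) | yes _    | yes _    = ε
      coherent g≈h u~v (inj₁ p) (inj₂ q) | yes refl | yes refl = contradiction (p ◅◅ u~v ◅◅ EqClosure.symmetric _ q) separate
      coherent g≈h u~v (inj₂ p) (inj₁ q) | yes refl | yes refl =
        contradiction (q ◅◅ EqClosure.symmetric _ (p ◅◅ u~v)) separate
      forced : ∀ {g v} → member′ g ≡ true → IsEnd g v → choice v ≈′ g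
      forced {g} {v} m end = case end? v of λ
        { (yes p) → at-end p (ρ-end p) (partnerAt-incident P (ρ v))
        ; (no ¬p) → away (subst (λ u → F u ≈ g) (sym (ρ-id ¬p)) (partnerAt-forced P mg end)) (partnerAt-incident P (ρ v)) }
        where
        g≢f : g ≢ f
        g≢f p = member′-e (inj₂ p) me∧mf m
        g≢e : g ≢ e
        g≢e p = member′-e (inj₁ p) me∧mf m
        mg : member g ≡ true
        mg = free-member⁻ g≢e g≢f m
        ρ-end : (p : IsEnd e v) → ρ v ≡ opposite-end p
        ρ-end (inj₁ refl) = ρ-apex
        ρ-end (inj₂ refl) = ρ-other
        away : ∀ {h u} → h ≈ g → (inc : Incident h u) → redirect h inc ≈′ g
        away {h} h≈g inc with h ≟ᵀˢ f
        ... | no _     = weaken≈ h≈g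
        ... | yes refl = contradiction (≈f (EqClosure.symmetric _ h≈g)) g≢f
        at-f : ∀ {h u} → h ≡ f → (p : IsEnd e v) → u ≡ opposite-end p → (inc : Incident h u) → redirect h inc ≈′ g
        at-f {h} h≡f p r inc with h ≟ᵀˢ f
        at-f h≡f p r inc | no ¬q = contradiction h≡f ¬q
        at-f h≡f (inj₁ refl) refl (inj₁ q) | yes refl = contradiction q separate
        at-f h≡f (inj₁ refl) refl (inj₂ q) | yes refl = weaken≈ (partnerAt-forced P mg end)
        at-f h≡f (inj₂ refl) refl (inj₁ q) | yes refl = weaken≈ (partnerAt-forced P mg end)
        at-f h≡f (inj₂ refl) refl (inj₂ q) | yes refl = contradiction (EqClosure.symmetric _ q) separate
        opposite∈f : (p : IsEnd e v) → IsEnd f (opposite-end p)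
        opposite∈f (inj₁ _) = inj₂ refl
        opposite∈f (inj₂ _) = inj₁ refl
        at-end : (p : IsEnd e v) → ρ v ≡ opposite-end p → (inc : Incident (F (ρ v)) (ρ v)) →
                 redirect (F (ρ v)) inc ≈′ g
        at-end p r inc = at-f (≈f (partnerAt-forced P mf (subst (IsEnd f) (sym r) (opposite∈f p)))) p r inc

    glued : member e ∨ member f ≡ true →
            ∃ λ (P′ : PerfectMatching (glue ⟦ (e , f) ∷ L ⟧)) → PerfectMatching.member P′ ≡ member′
    glued = cases refl refl
      where
      cases : ∀ {x y} → member e ≡ x → member f ≡ y → x ∨ y ≡ true →
              ∃ λ (P′ : PerfectMatching (glue ⟦ (e , f) ∷ L ⟧)) → PerfectMatching.member P′ ≡ member′
      cases {true}  {true}  me mf _ = bothMatched me mf , refl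
      cases {true}  {false} me mf _ = onlyE me mf , refl
      cases {false} {true}  me mf _ = onlyF me mf , refl

  -- Cutting off a tile that hangs on one side

  module Unglue (untouched : ∀ {g h} → (g , h) ∈ L → proj₁ g ≢ proj₁ e × proj₁ h ≢ proj₁ e)
                (elsewhere : proj₁ f ≢ proj₁ e)
                (P′ : PerfectMatching (glue ⟦ (e , f) ∷ L ⟧)) where
    open PerfectMatching P′
    open Graph (glue ⟦ L ⟧) using (Incident)
    open Graph (glue ⟦ (e , f) ∷ L ⟧) using () renaming (Incident to Incident′)

    i : Fin n
    i = proj₁ e

    s : Side
    s = proj₂ e

    F : TileCorner n → TileSide n
    F = partnerAt P′

    -- The counterpart of ρ on tile sides.
    σ : TileSide n → TileSide n
    σ g with g ≟ᵀˢ e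
    ... | yes _ = f
    ... | no _  = g

    σ-e : σ e ≡ f
    σ-e with e ≟ᵀˢ e
    ... | yes _ = refl
    ... | no ¬p = contradiction refl ¬p

    σ-id : ∀ {g} → g ≢ e → σ g ≡ g
    σ-id {g} ¬p with g ≟ᵀˢ e
    ... | yes p = contradiction p ¬p
    ... | no _  = refl

    σ-step : ∀ {g h} → (g , h) ∈ ((e , f) ∷ L) → σ g ≈ σ h
    σ-step (here refl) rewrite σ-e | σ-id (e≢f ∘ sym) = ε
    σ-step (there r) rewrite σ-id (proj₁ (freshᵉ r)) | σ-id (proj₂ (freshᵉ r)) = EqClosure.return r

    σ-cong : ∀ {g h} → g ≈′ h → σ g ≈ σ h
    σ-cong = gfold (EqClosure.isEquivalence _) σ σ-step

    untouchedᶜ : ∀ {u v} → CornerGlueing ⟦ L ⟧ u v → proj₁ u ≢ i × proj₁ v ≢ i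
    untouchedᶜ (apex-other r) = untouched r
    untouchedᶜ (other-apex r) = untouched r

    stay≈′ : ∀ {g h} → proj₁ g ≡ i → g ≢ e → g ≈′ h → h ≡ g
    stay≈′ {g} refl g≢e = isolated λ
      { (here refl) → (λ p → g≢e (sym p)) , λ { refl → elsewhere refl }
      ; (there r)   → (λ { refl → proj₁ (untouched r) refl }) , λ { refl → proj₂ (untouched r) refl } }

    away : ∀ {v} → proj₁ v ≢ i → ¬ IsEnd e v
    away p (inj₁ refl) = p refl
    away p (inj₂ refl) = p refl

    -- Two matched sides at a common corner would be one edge, but a side of this tile other than
    -- `e` is glued to nothing.
    exclusive : ∀ {t t′ κ} → t ≢ s → t′ ≢ t → IsEnd (i , t) κ → IsEnd (i , t′) κ →
                member (i , t) ≡ true → member (i , t′) ≡ false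
    exclusive {t} {t′} {κ} t≢s t′≢t p q m with member (i , t′) in m′
    ... | false = refl
    ... | true  = contradiction (cong proj₂ (stay≈′ refl (t≢s ∘ cong proj₂)
                    (EqClosure.symmetric _ (partnerAt-forced P′ m p) ◅◅ partnerAt-forced P′ m′ q))) t′≢t

    stay~′ : ∀ {u v} → proj₁ u ≡ i → ¬ IsEnd e u → u ~′ v → v ≡ u
    stay~′ refl ¬p = isolated λ
      { (apex-other (here refl)) → (λ { refl → ¬p (inj₁ refl) }) , λ { refl → elsewhere refl }
      ; (other-apex (here refl)) → (λ { refl → ¬p (inj₂ refl) }) , λ { refl → elsewhere refl }
      ; (apex-other (there r))   → (λ { refl → proj₁ (untouched r) refl }) , λ { refl → proj₂ (untouched r) refl }
      ; (other-apex (there r))   → (λ { refl → proj₁ (untouched r) refl }) , λ { refl → proj₂ (untouched r) refl } }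

    -- A corner away from `e` is a vertex of its own, so only sides of the same tile can cover it.
    covering : ∀ {κ} → proj₁ κ ≡ i → ¬ IsEnd e κ → ∃ λ t → member (i , t) ≡ true × IsEnd (i , t) κ
    covering {κ} refl ¬p = locate (partnerAt-member P′ κ) (partnerAt-incident P′ κ)
      where
      locate : ∀ {g} → member g ≡ true → Incident′ g κ → ∃ λ t → member (i , t) ≡ true × IsEnd (i , t) κ
      locate m (inj₁ r) with refl ← stay~′ refl ¬p (EqClosure.symmetric _ r) = _ , m , inj₁ refl
      locate m (inj₂ r) with refl ← stay~′ refl ¬p (EqClosure.symmetric _ r) = _ , m , inj₂ refl

    module _ (member⁻ : TileSide n → Bool) (o : Pair)
             (onTile : ∀ t → member⁻ (i , t) ≡ t ∈ᴾ o)
             (choice : TileCorner n → TileSide n) where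

      extend : TileCorner n → TileSide n
      extend κ with proj₁ κ ≟ i
      ... | yes _ = i , sideAt o (proj₂ κ)
      ... | no _  = choice κ

      extend-off : ∀ {κ} → proj₁ κ ≢ i → extend κ ≡ choice κ
      extend-off {κ} ¬p with proj₁ κ ≟ i
      ... | yes p = contradiction p ¬p
      ... | no _  = refl

      -- On tile `i` the pair `o` prescribes the partners, elsewhere `choice` does. No glueing of
      -- `L` touches tile `i`, so the two parts never have to be compared.
      assemble : (∀ {g h} → (g , h) ∈ L → member⁻ g ≡ member⁻ h) →
                 (∀ {v} → proj₁ v ≢ i → member⁻ (choice v) ≡ true) →
                 (∀ {v} → proj₁ v ≢ i → Incident (choice v) v) →
                 (∀ {u v} → CornerGlueing ⟦ L ⟧ u v → choice u ≈ choice v) →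
                 (∀ {g v} → proj₁ g ≢ i → member⁻ g ≡ true → IsEnd g v → choice v ≈ g) →
                 PerfectMatching (glue ⟦ L ⟧)
      assemble resp chosen incident coherent forced = fromChoice member⁻ resp extend
        chosen′ incident′ coherent′ forced′
        where
        chosen′ : ∀ v → member⁻ (extend v) ≡ true
        chosen′ v with proj₁ v ≟ i
        ... | yes _ = trans (onTile _) (sideAt-∈ᴾ o (proj₂ v))
        ... | no ¬p = chosen ¬p
        incident′ : ∀ v → Incident (extend v) v
        incident′ v with proj₁ v ≟ i
        ... | no ¬p    = incident ¬p
        ... | yes refl with sideAt-end o (proj₂ v)
        ...   | inj₁ p = inj₁ (subst (λ c → apexOf (i , sideAt o (proj₂ v)) ~ (i , c)) p ε)
        ...   | inj₂ p = inj₂ (subst (λ c → otherOf (i , sideAt o (proj₂ v)) ~ (i , c)) p ε)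
        coherent′ : ∀ {u v} → CornerGlueing ⟦ L ⟧ u v → extend u ≈ extend v
        coherent′ {u} {v} c = subst₂ _≈_ (sym (extend-off {u} (proj₁ (untouchedᶜ c))))
                                         (sym (extend-off {v} (proj₂ (untouchedᶜ c)))) (coherent c)
        forced′ : ∀ {g v} → member⁻ g ≡ true → IsEnd g v → extend v ≈ g
        forced′ {g} {v} m p with proj₁ v ≟ i
        forced′ m (inj₁ refl) | no ¬i    = forced ¬i m (inj₁ refl)
        forced′ m (inj₂ refl) | no ¬i    = forced ¬i m (inj₂ refl)
        forced′ {_ , t} m (inj₁ refl) | yes refl =
          subst (λ t′ → (i , t′) ≈ (i , t)) (sym (sideAt-apex t o (trans (sym (onTile t)) m))) ε
        forced′ {_ , t} m (inj₂ refl) | yes refl =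
          subst (λ t′ → (i , t′) ≈ (i , t)) (sym (sideAt-otherEnd t o (trans (sym (onTile t)) m))) ε

    Unglued : Set
    Unglued = ∃ λ (P : PerfectMatching (glue ⟦ L ⟧)) →
      PerfectMatching.member P e ∨ PerfectMatching.member P f ≡ true ×
      (∀ g → member g ≡ join (e , f) (PerfectMatching.member P) g)

    member-e≡f : member e ≡ member f
    member-e≡f = respects e≈′f

    apexCorner otherCorner : TileCorner n
    apexCorner  = i , apex (oppositeSide s)
    otherCorner = i , otherEnd (oppositeSide s)

    apexCorner-free : ¬ IsEnd e apexCorner
    apexCorner-free = [ proj₁ (apex-oppositeSide s) ∘ cong proj₂ , proj₂ (apex-oppositeSide s) ∘ cong proj₂ ]′

    otherCorner-free : ¬ IsEnd e otherCorner
    otherCorner-free = [ proj₁ (otherEnd-oppositeSide s) ∘ cong proj₂ , proj₂ (otherEnd-oppositeSide s) ∘ cong proj₂ ]′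

    -- The tile meets the others only at the ends of `e`, and `ρ` moves these to the ends of `f`.
    incident-f : ∀ {κ v} → proj₁ κ ≡ i → proj₁ v ≢ i → κ ~′ v → Incident f v
    incident-f {κ} κ∈i v∉i p with end? κ
    ... | yes (inj₁ refl) = inj₂ (subst₂ _~_ ρ-apex (ρ-id (away v∉i)) (ρ-cong p))
    ... | yes (inj₂ refl) = inj₁ (subst₂ _~_ ρ-other (ρ-id (away v∉i)) (ρ-cong p))
    ... | no free         = contradiction (trans (cong proj₁ (stay~′ κ∈i free p)) κ∈i) v∉i

    incident-on : ∀ {g v} → proj₁ g ≡ i → proj₁ v ≢ i → Incident′ g v → Incident f v
    incident-on g∈i v∉i = [ incident-f g∈i v∉i , incident-f g∈i v∉i ]′

    incident-off : ∀ {g v} → proj₁ g ≢ i → proj₁ v ≢ i → Incident′ g v → Incident g v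
    incident-off g∉i v∉i (inj₁ p) = inj₁ (subst₂ _~_ (ρ-id (away g∉i)) (ρ-id (away v∉i)) (ρ-cong p))
    incident-off g∉i v∉i (inj₂ p) = inj₂ (subst₂ _~_ (ρ-id (away g∉i)) (ρ-id (away v∉i)) (ρ-cong p))

    F-cong : ∀ {u v} → CornerGlueing ⟦ L ⟧ u v → F u ≈′ F v
    F-cong c = partnerAt-resp P′ (weaken~ (EqClosure.return c))

    respects-old : ∀ {g h} → (g , h) ∈ L → member g ≡ member h
    respects-old r = respects (EqClosure.return (there r))

    join-member : ∀ (b : TileSide n → Bool) → b e ∧ b f ≡ member e →
                  (∀ {g} → g ≢ e → g ≢ f → b g ≡ member g) → ∀ g → member g ≡ join (e , f) b g
    join-member b be∧bf off g with g ≟ᵀˢ e | g ≟ᵀˢ f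
    ... | yes refl | _        = sym be∧bf
    ... | no _     | yes refl = trans (sym member-e≡f) (sym be∧bf)
    ... | no p     | no q     = sym (off p q)

    -- If the side opposite to e is matched, then e belongs to the matching
    -- of the separated tile; otherwise the other two sides are matched, and
    -- it is f that has to be matched after ungluing.
    alongCase : member (i , oppositeSide s) ≡ true → Unglued
    alongCase m =
      assemble member⁻ (pairOf s) onTile (σ ∘ F) resp
        (λ {v} _ → chosen (F v) (partnerAt-member P′ v))
        (λ {v} v∉i → incident (partnerAt-member P′ v) v∉i (partnerAt-incident P′ v))
        (λ c → σ-cong (F-cong c))
        forced ,
      cong (_∨ member⁻ f) (at-e refl) ,
      join-member member⁻ (trans (cong₂ _∧_ (at-e refl) (off-e (e≢f ∘ sym))) (sym member-e≡f)) (λ p _ → off-e p)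
      where
      -- `e` is added even if the glued edge is unmatched: `f` is then unmatched too, and the
      -- conjunction in `join` removes `e` again.
      member⁻ : TileSide n → Bool
      member⁻ g = does (g ≟ᵀˢ e) ∨ member g
      at-e : ∀ {g} → g ≡ e → member⁻ g ≡ true
      at-e {g} p rewrite dec-true (g ≟ᵀˢ e) p = refl
      off-e : ∀ {g} → g ≢ e → member⁻ g ≡ member g
      off-e {g} ¬p rewrite dec-false (g ≟ᵀˢ e) ¬p = refl
      apexNeighbour-false : member (i , apexNeighbour s) ≡ false
      apexNeighbour-false = exclusive (oppositeSide≢ s) (proj₂ (apexNeighbour≢ s))
        (inj₂ refl) (inj₂ (cong (i ,_) (proj₂ (apexNeighbour-ends s)))) m
      otherNeighbour-false : member (i , otherNeighbour s) ≡ false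
      otherNeighbour-false = exclusive (oppositeSide≢ s) (proj₂ (otherNeighbour≢ s))
        (inj₁ refl) (inj₁ (cong (i ,_) (proj₁ (otherNeighbour-ends s)))) m
      onTile : ∀ t → member⁻ (i , t) ≡ t ∈ᴾ pairOf s
      onTile t with relative s t
      ... | itself  = trans (at-e refl) (sym (proj₁ (∈ᴾ-pairOf s)))
      ... | across  = trans (off-e (oppositeSide≢ s ∘ cong proj₂))
                            (trans m (sym (proj₁ (proj₂ (∈ᴾ-pairOf s)))))
      ... | atApex  = trans (off-e (proj₁ (apexNeighbour≢ s) ∘ cong proj₂))
                            (trans apexNeighbour-false (sym (proj₁ (proj₂ (proj₂ (∈ᴾ-pairOf s))))))
      ... | atOther = trans (off-e (proj₁ (otherNeighbour≢ s) ∘ cong proj₂))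
                            (trans otherNeighbour-false (sym (proj₂ (proj₂ (proj₂ (∈ᴾ-pairOf s))))))
      resp : ∀ {g h} → (g , h) ∈ L → member⁻ g ≡ member⁻ h
      resp r = trans (off-e (proj₁ (freshᵉ r))) (trans (respects-old r) (sym (off-e (proj₂ (freshᵉ r)))))
      chosen : ∀ g → member g ≡ true → member⁻ (σ g) ≡ true
      chosen g mg with g ≟ᵀˢ e
      ... | yes refl = trans (off-e (e≢f ∘ sym)) (trans (sym member-e≡f) mg)
      ... | no ¬p    = trans (off-e ¬p) mg
      incident-tile : ∀ {t v} → (i , t) ≢ e → member (i , t) ≡ true → proj₁ v ≢ i → Incident′ (i , t) v → Incident (i , t) v
      incident-tile {t} t≢s mg v∉i inc with relative s t
      ... | itself  = contradiction refl t≢s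
      ... | atApex  = contradiction (trans (sym apexNeighbour-false) mg) λ ()
      ... | atOther = contradiction (trans (sym otherNeighbour-false) mg) λ ()
      incident-tile t≢s mg v∉i (inj₁ p) | across = contradiction (cong proj₁ (stay~′ refl apexCorner-free p)) v∉i
      incident-tile t≢s mg v∉i (inj₂ p) | across = contradiction (cong proj₁ (stay~′ refl otherCorner-free p)) v∉i
      incident : ∀ {g v} → member g ≡ true → proj₁ v ≢ i → Incident′ g v → Incident (σ g) v
      incident {g} mg v∉i inc with g ≟ᵀˢ e
      ... | yes refl = incident-on refl v∉i inc
      ... | no ¬p with proj₁ g ≟ i
      ...   | yes refl = incident-tile ¬p mg v∉i inc
      ...   | no g∉i   = incident-off g∉i v∉i inc
      forced : ∀ {g v} → proj₁ g ≢ i → member⁻ g ≡ true → IsEnd g v → σ (F v) ≈ g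
      forced g∉i mg end = subst (_ ≈_) (σ-id g≢e) (σ-cong (partnerAt-forced P′ (trans (sym (off-e g≢e)) mg) end))
        where
        g≢e = g∉i ∘ cong proj₁

    acrossCase : member (i , oppositeSide s) ≡ false → Unglued
    acrossCase ¬m =
      assemble member⁻ (otherPair (pairOf s)) onTile (τ ∘ F) resp
        (λ {v} _ → chosen (F v) (partnerAt-member P′ v))
        (λ {v} v∉i → incident (partnerAt-member P′ v) v∉i (partnerAt-incident P′ v))
        (λ {u} {v} c → coherent (partnerAt-member P′ u) (partnerAt-member P′ v) (F-cong c))
        forced ,
      trans (cong (member⁻ e ∨_) (at-f refl)) (∨-zeroʳ (member⁻ e)) ,
      join-member member⁻ (trans (cong₂ _∧_ (off-f e≢f) (at-f refl)) (∧-identityʳ _)) (λ _ p → off-f p)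
      where
      -- Adding `f` does not change the glued edge: `e` is unmatched here, so the conjunction stays
      -- false.
      member⁻ : TileSide n → Bool
      member⁻ g = does (g ≟ᵀˢ f) ∨ member g
      at-f : ∀ {g} → g ≡ f → member⁻ g ≡ true
      at-f {g} p rewrite dec-true (g ≟ᵀˢ f) p = refl
      off-f : ∀ {g} → g ≢ f → member⁻ g ≡ member g
      off-f {g} ¬p rewrite dec-false (g ≟ᵀˢ f) ¬p = refl
      -- The only matched sides of this tile are the neighbours of `e`. Off the tile they cover just
      -- the ends of `f`, where `f` now takes over.
      τ : TileSide n → TileSide n
      τ g with proj₁ g ≟ i
      ... | yes _ = f
      ... | no _  = g
      τ-on : ∀ {g} → proj₁ g ≡ i → τ g ≡ f
      τ-on {g} p with proj₁ g ≟ i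
      ... | yes _ = refl
      ... | no ¬p = contradiction p ¬p
      -- The two corners away from `e` belong to this tile alone. As the side between them is
      -- unmatched, each must be covered by the remaining side through it.
      apexNeighbour-true : member (i , apexNeighbour s) ≡ true
      apexNeighbour-true with t , mt , end ← covering refl otherCorner-free with relative s t
      ... | itself  = contradiction end otherCorner-free
      ... | across  = contradiction (trans (sym ¬m) mt) λ ()
      ... | atApex  = mt
      ... | atOther = contradiction end [ (λ p → apex≢otherEnd (oppositeSide s) (trans (proj₁ (otherNeighbour-ends s)) (sym (cong proj₂ p))))
                                        , (λ p → proj₂ (otherEnd-oppositeSide s) (trans (cong proj₂ p) (sym (proj₂ (otherNeighbour-ends s))))) ]′
      otherNeighbour-true : member (i , otherNeighbour s) ≡ true
      otherNeighbour-true with t , mt , end ← covering refl apexCorner-free with relative s t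
      ... | itself  = contradiction end apexCorner-free
      ... | across  = contradiction (trans (sym ¬m) mt) λ ()
      ... | atApex  = contradiction end [ (λ p → proj₁ (apex-oppositeSide s) (trans (cong proj₂ p) (sym (proj₁ (apexNeighbour-ends s)))))
                                        , (λ p → apex≢otherEnd (oppositeSide s) (trans (cong proj₂ p) (sym (proj₂ (apexNeighbour-ends s))))) ]′
      ... | atOther = mt
      e-false : member e ≡ false
      e-false = exclusive (proj₁ (apexNeighbour≢ s)) (proj₁ (apexNeighbour≢ s) ∘ sym)
        (inj₁ (cong (i ,_) (proj₁ (apexNeighbour-ends s)))) (inj₁ refl) apexNeighbour-true
      member≢e : ∀ {g} → member g ≡ true → g ≢ e
      member≢e mg refl = contradiction (trans (sym e-false) mg) λ ()
      onTile : ∀ t → member⁻ (i , t) ≡ t ∈ᴾ otherPair (pairOf s)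
      onTile t = trans (off-f (λ { refl → elsewhere refl })) (trans (value t) (sym (∈ᴾ-otherPair t (pairOf s))))
        where
        value : ∀ t → member (i , t) ≡ not (t ∈ᴾ pairOf s)
        value t with relative s t
        ... | itself  = trans e-false (sym (cong not (proj₁ (∈ᴾ-pairOf s))))
        ... | across  = trans ¬m (sym (cong not (proj₁ (proj₂ (∈ᴾ-pairOf s)))))
        ... | atApex  = trans apexNeighbour-true (sym (cong not (proj₁ (proj₂ (proj₂ (∈ᴾ-pairOf s))))))
        ... | atOther = trans otherNeighbour-true (sym (cong not (proj₂ (proj₂ (proj₂ (∈ᴾ-pairOf s))))))
      resp : ∀ {g h} → (g , h) ∈ L → member⁻ g ≡ member⁻ h
      resp r = trans (off-f (proj₁ (fresh r))) (trans (respects-old r) (sym (off-f (proj₂ (fresh r)))))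
      chosen : ∀ g → member g ≡ true → member⁻ (τ g) ≡ true
      chosen g mg with proj₁ g ≟ i
      ... | yes _ = at-f refl
      ... | no _  = trans (cong (does (g ≟ᵀˢ f) ∨_) mg) (∨-zeroʳ _)
      incident : ∀ {g v} → member g ≡ true → proj₁ v ≢ i → Incident′ g v → Incident (τ g) v
      incident {g} mg v∉i inc with proj₁ g ≟ i
      ... | yes g∈i = incident-on g∈i v∉i inc
      ... | no g∉i  = incident-off g∉i v∉i inc
      coherent : ∀ {g h} → member g ≡ true → member h ≡ true → g ≈′ h → τ g ≈ τ h
      coherent {g} {h} mg mh g≈h with proj₁ g ≟ i | proj₁ h ≟ i
      ... | yes _ | yes _ = ε
      ... | yes p | no ¬p = contradiction (trans (cong proj₁ (stay≈′ p (member≢e mg) g≈h)) p) ¬p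
      ... | no ¬p | yes p = contradiction (trans (cong proj₁ (stay≈′ p (member≢e mh) (EqClosure.symmetric _ g≈h))) p) ¬p
      ... | no p  | no q  = subst₂ _≈_ (σ-id (member≢e mg)) (σ-id (member≢e mh)) (σ-cong g≈h)
      forced : ∀ {g v} → proj₁ g ≢ i → member⁻ g ≡ true → IsEnd g v → τ (F v) ≈ g
      forced {g} {v} g∉i mg end with g ≟ᵀˢ f
      -- The apex of `f` is identified with the other end of `e`, which `otherNeighbour s` covers.
      -- So the partner lies on the cut tile and `τ` sends it to `f`.
      forced {v = v} g∉i _ (inj₁ refl) | yes refl = subst (_≈ f) (sym (τ-on (cong proj₁ Fv))) ε
        where
        Fv : F v ≡ (i , otherNeighbour s)
        Fv = stay≈′ refl (proj₁ (otherNeighbour≢ s) ∘ cong proj₂) (EqClosure.symmetric _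
          (partnerAt-resp P′ (EqClosure.symmetric _ (EqClosure.return (other-apex (here refl))))
            ◅◅ partnerAt-forced P′ otherNeighbour-true (inj₂ (cong (i ,_) (proj₂ (otherNeighbour-ends s))))))
      forced {v = v} g∉i _ (inj₂ refl) | yes refl = subst (_≈ f) (sym (τ-on (cong proj₁ Fv))) ε
        where
        Fv : F v ≡ (i , apexNeighbour s)
        Fv = stay≈′ refl (proj₁ (apexNeighbour≢ s) ∘ cong proj₂) (EqClosure.symmetric _
          (partnerAt-resp P′ (EqClosure.symmetric _ (EqClosure.return (apex-other (here refl))))
            ◅◅ partnerAt-forced P′ apexNeighbour-true (inj₁ (cong (i ,_) (proj₁ (apexNeighbour-ends s))))))
      forced {g} {v} g∉i mg end | no _ with proj₁ (F v) ≟ i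
      ... | yes p = contradiction (trans (cong proj₁ (stay≈′ p (member≢e (partnerAt-member P′ v)) (partnerAt-forced P′ mg end))) p) g∉i
      ... | no _  = subst₂ _≈_ (σ-id (member≢e (partnerAt-member P′ v))) (σ-id (g∉i ∘ cong proj₁)) (σ-cong (partnerAt-forced P′ mg end))

    unglue : Unglued
    unglue with member (i , oppositeSide s) in m
    ... | true  = alongCase m
    ... | false = acrossCase m

-- Matchings of glued tiles

joinAll : ∀ {n} → Glueing n → (TileSide n → Bool) → TileSide n → Bool
joinAll L b = foldr join b L

Covers : ∀ {n} → (TileSide n → Bool) → Glueing n → Set
Covers b L = ∀ {e f} → (e , f) ∈ L → b e ∨ b f ≡ true

Free : ∀ {n} → Glueing n → TileSide n → Set
Free L g = ∀ {e f} → (e , f) ∈ L → e ≢ g × f ≢ g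

data WellFormed {n} : Glueing n → Set where
  []  : WellFormed []
  _∷_ : ∀ {L e f} → Attachable L e f → WellFormed L → WellFormed ((e , f) ∷ L)

-- Every pair hangs a new tile, that of `e`, onto the tiles glued by the rest of the list. Snakes
-- have this form; a loop pair reuses an end tile that is already attached.
data Chain {n} : Glueing n → Set where
  []   : Chain []
  link : ∀ {L e f} → (∀ {g h} → (g , h) ∈ L → proj₁ g ≢ proj₁ e × proj₁ h ≢ proj₁ e) →
         proj₁ f ≢ proj₁ e → Chain L → Chain ((e , f) ∷ L)

join-cong : ∀ {n} {p : TileSide n × TileSide n} {b c} → (∀ g → b g ≡ c g) → ∀ g → join p b g ≡ join p c g
join-cong {p = e , f} b≗c g = cong₂ (λ x y → if does ((g ≟ᵀˢ e) ⊎-dec (g ≟ᵀˢ f)) then x else y)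
                                    (cong₂ _∧_ (b≗c e) (b≗c f)) (b≗c g)

joinAll-cong : ∀ {n} (L : Glueing n) {b c} → (∀ g → b g ≡ c g) → ∀ g → joinAll L b g ≡ joinAll L c g
joinAll-cong []      b≗c = b≗c
joinAll-cong (_ ∷ L) b≗c = join-cong (joinAll-cong L b≗c)

joinAll-free : ∀ {n} {b} {L : Glueing n} {g} → Free L g → joinAll L b g ≡ b g
joinAll-free {L = []}          free = refl
joinAll-free {b = b} {(e , f) ∷ L} free =
  trans (join-free (joinAll L b) (proj₁ (free (here refl)) ∘ sym) (proj₂ (free (here refl)) ∘ sym))
        (joinAll-free {L = L} (λ p → free (there p)))

module _ {n} {L : Glueing n} {e f} (A : Attachable L e f) (b : TileSide n → Bool) where

  joinAll-e : joinAll L b e ≡ b e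
  joinAll-e = joinAll-free {L = L} (Attach.freshᵉ A)

  joinAll-f : joinAll L b f ≡ b f
  joinAll-f = joinAll-free {L = L} (Attachable.fresh A)

Partner : ∀ {n} → Glueing n → TileSide n → TileSide n → Set
Partner L g h = (g , h) ∈ L ⊎ (h , g) ∈ L

there-partner : ∀ {n} {L : Glueing n} {p g h} → Partner L g h → Partner (p ∷ L) g h
there-partner = map⊎ there there

partner-free : ∀ {n} {L : Glueing n} {g h k} → Free L k → Partner L g h → g ≢ k × h ≢ k
partner-free free (inj₁ r) = free r
partner-free free (inj₂ r) = proj₂ (free r) , proj₁ (free r)

-- Each pair consists of sides that the rest of the list does not use, so no other `join` interferes
-- with the conjunction made at this pair.
joinAll-partner : ∀ {n} {b} {L : Glueing n} {g h} → WellFormed L → Partner L g h →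
                  joinAll L b g ≡ b g ∧ b h
joinAll-partner {b = b} {L = _ ∷ L} (A ∷ _) (inj₁ (here refl)) =
  trans (join-glued (joinAll L b) (inj₁ refl)) (cong₂ _∧_ (joinAll-e A b) (joinAll-f A b))
joinAll-partner {b = b} {L = _ ∷ L} (A ∷ _) (inj₂ (here refl)) =
  trans (join-glued (joinAll L b) (inj₂ refl)) (trans (cong₂ _∧_ (joinAll-e A b) (joinAll-f A b)) (∧-comm (b _) (b _)))
joinAll-partner {b = b} {L = _ ∷ L} (A ∷ wf) (inj₁ (there r)) =
  trans (join-free (joinAll L b) (proj₁ (Attach.freshᵉ A r)) (proj₁ (Attachable.fresh A r))) (joinAll-partner wf (inj₁ r))
joinAll-partner {b = b} {L = _ ∷ L} (A ∷ wf) (inj₂ (there r)) =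
  trans (join-free (joinAll L b) (proj₂ (Attach.freshᵉ A r)) (proj₂ (Attachable.fresh A r))) (joinAll-partner wf (inj₂ r))

covers-partner : ∀ {n} {b} {L : Glueing n} {g h} → Covers b L → Partner L g h → b g ∨ b h ≡ true
covers-partner cov (inj₁ r) = cov r
covers-partner {b = b} {g = g} {h} cov (inj₂ r) = trans (∨-comm (b g) (b h)) (cov r)

partner? : ∀ {n} (L : Glueing n) g → Free L g ⊎ ∃ λ h → Partner L g h
partner? [] g = inj₁ λ ()
partner? ((e , f) ∷ L) g with g ≟ᵀˢ e | g ≟ᵀˢ f | partner? L g
... | yes refl | _        | _              = inj₂ (f , inj₁ (here refl))
... | no _     | yes refl | _              = inj₂ (e , inj₂ (here refl))
... | no _     | no _     | inj₂ (h , p)   = inj₂ (h , there-partner p)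
... | no ¬p    | no ¬q    | inj₁ free      = inj₁ λ { (here refl) → (λ p → ¬p (sym p)) , (λ q → ¬q (sym q))
                                                    ; (there r)   → free r }

uncons-partner : ∀ {n} {L : Glueing n} {e f g h} → Partner ((e , f) ∷ L) g h →
                 (g ≡ e × h ≡ f ⊎ g ≡ f × h ≡ e) ⊎ Partner L g h
uncons-partner (inj₁ (here refl)) = inj₁ (inj₁ (refl , refl))
uncons-partner (inj₂ (here refl)) = inj₁ (inj₂ (refl , refl))
uncons-partner (inj₁ (there r))   = inj₂ (inj₁ r)
uncons-partner (inj₂ (there r))   = inj₂ (inj₂ r)

partner-unique : ∀ {n} {L : Glueing n} {g h k} → WellFormed L → Partner L g h → Partner L g k → h ≡ k
partner-unique []       (inj₁ ())
partner-unique []       (inj₂ ())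
partner-unique (A ∷ wf) p q with uncons-partner p | uncons-partner q
... | inj₁ (inj₁ (refl , refl)) | inj₁ (inj₁ (_ , refl)) = refl
... | inj₁ (inj₁ (refl , refl)) | inj₁ (inj₂ (e≡f , _))  = contradiction e≡f (Attach.e≢f A)
... | inj₁ (inj₂ (refl , refl)) | inj₁ (inj₁ (f≡e , _))  = contradiction (sym f≡e) (Attach.e≢f A)
... | inj₁ (inj₂ (refl , refl)) | inj₁ (inj₂ (_ , refl)) = refl
... | inj₁ (inj₁ (refl , _))    | inj₂ q′ = contradiction refl (proj₁ (partner-free (Attach.freshᵉ A) q′))
... | inj₁ (inj₂ (refl , _))    | inj₂ q′ = contradiction refl (proj₁ (partner-free (Attachable.fresh A) q′))
... | inj₂ p′ | inj₁ (inj₁ (refl , _)) = contradiction refl (proj₁ (partner-free (Attach.freshᵉ A) p′))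
... | inj₂ p′ | inj₁ (inj₂ (refl , _)) = contradiction refl (proj₁ (partner-free (Attachable.fresh A) p′))
... | inj₂ p′ | inj₂ q′ = partner-unique wf p′ q′

free-class : ∀ {n} {L : Glueing n} {g h} → Free L g → EqClosure ⟦ L ⟧ g h → h ≡ g
free-class free = isolated free

partner-class : ∀ {n} {L : Glueing n} {g h k} → WellFormed L → Partner L g h →
                EqClosure ⟦ L ⟧ g k → k ≡ g ⊎ k ≡ h
partner-class {L = L} {g} {h} wf p = go (inj₁ refl)
  where
  next : ∀ {x y} → Partner L x y → x ≡ g ⊎ x ≡ h → y ≡ g ⊎ y ≡ h
  next q (inj₁ refl) = inj₂ (partner-unique wf q p)
  next q (inj₂ refl) = inj₁ (partner-unique wf q (swap p))
  go : ∀ {x k} → x ≡ g ⊎ x ≡ h → EqClosure ⟦ L ⟧ x k → k ≡ g ⊎ k ≡ h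
  go x∈ ε           = x∈
  go x∈ (fwd r ◅ c) = go (next (inj₁ r) x∈) c
  go x∈ (bwd r ◅ c) = go (next (inj₂ r) x∈) c

partner-≈ : ∀ {n} {L : Glueing n} {g h} → Partner L g h → EqClosure ⟦ L ⟧ g h
partner-≈ (inj₁ r) = EqClosure.return r
partner-≈ (inj₂ r) = EqClosure.symmetric _ (EqClosure.return r)

-- When a pair is attached, neither of its sides has been glued yet. Both still show the state of
-- their tile, so the condition on tile states is exactly what this glueing needs.
glueAll : ∀ {n} {L : Glueing n} {b} → WellFormed L → Covers b L →
          (∃ λ (P : PerfectMatching (glue ⟦ [] ⟧)) → PerfectMatching.member P ≡ b) →
          ∃ λ (P : PerfectMatching (glue ⟦ L ⟧)) → PerfectMatching.member P ≡ joinAll L b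
glueAll [] cov P = P
glueAll {b = b} (A ∷ wf) cov P with Q , eq ← glueAll wf (λ r → cov (there r)) P
  with Q′ , eq′ ← Attach.Glue.glued A Q (trans (cong₂ _∨_ (trans (cong (λ m → m _) eq) (joinAll-e A b))
                                                          (trans (cong (λ m → m _) eq) (joinAll-f A b)))
                                               (cov (here refl)))
  = Q′ , trans eq′ (cong (join _) eq)

unglueAll : ∀ {n} {L : Glueing n} → WellFormed L → Chain L → (P : PerfectMatching (glue ⟦ L ⟧)) →
            ∃ λ (P₀ : PerfectMatching (glue ⟦ [] ⟧)) →
              Covers (PerfectMatching.member P₀) L ×
              (∀ g → PerfectMatching.member P g ≡ joinAll L (PerfectMatching.member P₀) g)
unglueAll [] [] P = P , (λ ()) , λ _ → refl
unglueAll {L = (e , f) ∷ L} (A ∷ wf) (link untouched elsewhere ch) P′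
  with P , covered , eq ← Attach.Unglue.unglue A untouched elsewhere P′
  with P₀ , cov , eq₀ ← unglueAll wf ch P
  = P₀
  , (λ { (here refl) → trans (sym (cong₂ _∨_ (trans (eq₀ e) (joinAll-e A b₀)) (trans (eq₀ f) (joinAll-f A b₀)))) covered
       ; (there r)   → cov r })
  , λ g → trans (eq g) (join-cong eq₀ g)
  where
  b₀ = PerfectMatching.member P₀

-- Matchings of disjoint tiles

tiles : ∀ {n} → (Fin n → Pair) → TileSide n → Bool
tiles o (i , s) = s ∈ᴾ o i

disjointTiles : ∀ {n} (o : Fin n → Pair) → ∃ λ (P : PerfectMatching (glue {n} ⟦ [] ⟧)) → PerfectMatching.member P ≡ tiles o
disjointTiles o = fromChoice (tiles o) (λ ())
  (λ { (i , c) → i , sideAt (o i) c })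
  (λ { (i , c) → sideAt-∈ᴾ (o i) c })
  (λ { (i , c) → [ inj₁ ∘ meets i , inj₂ ∘ meets i ]′ (sideAt-end (o i) c) })
  (λ { (apex-other ()) ; (other-apex ()) })
  (λ { {i , s} m (inj₁ refl) → same i (sideAt-apex s (o i) m)
     ; {i , s} m (inj₂ refl) → same i (sideAt-otherEnd s (o i) m) })
  , refl
  where
  meets : ∀ i {c d} → c ≡ d → EqClosure (CornerGlueing ⟦ [] ⟧) (i , c) (i , d)
  meets i refl = ε
  same : ∀ i {s t} → s ≡ t → EqClosure ⟦ [] ⟧ (i , s) (i , t)
  same i refl = ε

module _ {n} (P : PerfectMatching (glue {n} ⟦ [] ⟧)) where
  open PerfectMatching P

  private
    disjointᶜ : ∀ {u v} → EqClosure (CornerGlueing (⟦_⟧ {n} [])) u v → v ≡ u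
    disjointᶜ = isolated λ { (apex-other ()) ; (other-apex ()) }

    exclusive : ∀ {i κ s t} → IsEnd (i , s) κ → IsEnd (i , t) κ → s ≢ t →
                member (i , s) ≡ true → member (i , t) ≡ false
    exclusive {i} {t = t} p q s≢t m with member (i , t) in m′
    ... | false = refl
    ... | true  = contradiction (sym (cong proj₂ (isolated (λ ())
                    (EqClosure.symmetric _ (partnerAt-forced P m p) ◅◅ partnerAt-forced P m′ q)))) s≢t

    covering : ∀ κ → ∃ λ t → member (proj₁ κ , t) ≡ true × IsEnd (proj₁ κ , t) κ
    covering κ = locate (partnerAt-member P κ) (partnerAt-incident P κ)
      where
      locate : ∀ {g} → member g ≡ true → Graph.Incident (glue ⟦ [] ⟧) g κ →
               ∃ λ t → member (proj₁ κ , t) ≡ true × IsEnd (proj₁ κ , t) κ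
      locate m (inj₁ r) with refl ← disjointᶜ r = _ , m , inj₁ refl
      locate m (inj₂ r) with refl ← disjointᶜ r = _ , m , inj₂ refl

  -- The state of `N` settles the rest: sides at a common corner exclude each other, and every
  -- corner must be covered by one of its two sides.
  tilePair : ∀ i → ∃ λ o → ∀ s → member (i , s) ≡ s ∈ᴾ o
  tilePair i with member (i , N) in mN
  ... | true  = horizontal , λ { N → mN ; S → mS ; E → mE ; W → mW }
    where
    mE = exclusive (inj₁ refl) (inj₁ refl) (λ ()) mN
    mW = exclusive (inj₂ refl) (inj₂ refl) (λ ()) mN
    mS : member (i , S) ≡ true
    mS with covering (i , SW)
    ... | S , m , _ = m
    ... | W , m , _ = contradiction (trans (sym mW) m) λ ()
    ... | N , _ , inj₁ ()
    ... | N , _ , inj₂ ()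
    ... | E , _ , inj₁ ()
    ... | E , _ , inj₂ ()
  ... | false = vertical , λ { N → mN ; S → exclusive (inj₁ refl) (inj₁ refl) (λ ()) mW ; E → mE ; W → mW }
    where
    mE : member (i , E) ≡ true
    mE with covering (i , NE)
    ... | E , m , _ = m
    ... | N , m , _ = contradiction (trans (sym mN) m) λ ()
    ... | S , _ , inj₁ ()
    ... | S , _ , inj₂ ()
    ... | W , _ , inj₁ ()
    ... | W , _ , inj₂ ()
    mW : member (i , W) ≡ true
    mW with covering (i , NW)
    ... | W , m , _ = m
    ... | N , m , _ = contradiction (trans (sym mN) m) λ ()
    ... | S , _ , inj₁ ()
    ... | S , _ , inj₂ ()
    ... | E , _ , inj₁ ()
    ... | E , _ , inj₂ ()

∈ᴾ-injective : ∀ s {o p} → s ∈ᴾ o ≡ s ∈ᴾ p → o ≡ p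
∈ᴾ-injective s {horizontal} {horizontal} _ = refl
∈ᴾ-injective s {vertical}   {vertical}   _ = refl
∈ᴾ-injective N {horizontal} {vertical} ()
∈ᴾ-injective S {horizontal} {vertical} ()
∈ᴾ-injective E {horizontal} {vertical} ()
∈ᴾ-injective W {horizontal} {vertical} ()
∈ᴾ-injective N {vertical} {horizontal} ()
∈ᴾ-injective S {vertical} {horizontal} ()
∈ᴾ-injective E {vertical} {horizontal} ()
∈ᴾ-injective W {vertical} {horizontal} ()

otherPair-involutive : ∀ o → otherPair (otherPair o) ≡ o
otherPair-involutive horizontal = refl
otherPair-involutive vertical   = refl

-- For `z` false the conjunctions say nothing, but then both covering conditions force `x` and `y`
-- to be true.
∧-∨-determined : ∀ x y z → x ∨ z ≡ true → y ∨ z ≡ true → x ∧ z ≡ y ∧ z → x ≡ y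
∧-∨-determined x     y     true  _ _ p = trans (sym (∧-identityʳ x)) (trans p (∧-identityʳ y))
∧-∨-determined true  true  false _ _ _ = refl

-- Flipping the state of one tile

module Flips {n} {L : Glueing n} (wf : WellFormed L)
             (apart : ∀ {e f} → (e , f) ∈ L → proj₁ e ≢ proj₁ f) where

  infix 4 _≈_
  _≈_ : Rel (TileSide n) 0ℓ
  _≈_ = EqClosure ⟦ L ⟧

  matched : (Fin n → Pair) → TileSide n → Bool
  matched o = joinAll L (tiles o)

  flipped : Fin n → (Fin n → Pair) → Fin n → Pair
  flipped i o = updateAt o i otherPair

  tiles-flipped-on : ∀ o i s → tiles (flipped i o) (i , s) ≡ s ∈ᴾ otherPair (o i)
  tiles-flipped-on o i s = cong (s ∈ᴾ_) (updateAt-updates i o)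

  tiles-flipped-off : ∀ o i g → proj₁ g ≢ i → tiles (flipped i o) g ≡ tiles o g
  tiles-flipped-off o i (j , s) j≢i = cong (s ∈ᴾ_) (updateAt-minimal j i o j≢i)

  partner-apart : ∀ {g h} → Partner L g h → proj₁ g ≢ proj₁ h
  partner-apart (inj₁ r) p = apart r p
  partner-apart (inj₂ r) p = apart r (sym p)

  -- Glueing only removes sides from the tile matchings, so a single side of `p` that is still
  -- matched already identifies the state of the tile.
  matched-tile : ∀ o {i p} → (∀ s → matched o (i , s) ≡ s ∈ᴾ p) → o i ≡ p
  matched-tile o {i} {p} source = ∈ᴾ-injective s (trans (below (trans (source s) s∈p)) (sym s∈p))
    where
    s : Side
    s = sideAt p NE
    s∈p : s ∈ᴾ p ≡ true
    s∈p = sideAt-∈ᴾ p NE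
    below : ∀ {g} → matched o g ≡ true → tiles o g ≡ true
    below {g} m with partner? L g
    ... | inj₁ free    = trans (sym (joinAll-free {L = L} free)) m
    ... | inj₂ (h , q) = ∧-true (trans (sym (joinAll-partner wf q)) m)
      where
      ∧-true : ∀ {x y} → x ∧ y ≡ true → x ≡ true
      ∧-true {true} _ = refl

  module _ (o : Fin n → Pair) (cov : Covers (tiles o) L) (i : Fin n)
           (source : ∀ s → matched o (i , s) ≡ s ∈ᴾ o i) where

    -- The glueing leaves the side of tile `i` as it is. If that side is matched, the conjunction
    -- requires its partner; if not, the covering condition does.
    neighbour-true : ∀ {s h} → Partner L (i , s) h → tiles o h ≡ true
    neighbour-true {s} {h} q = solve (tiles o (i , s)) (covers-partner {b = tiles o} cov q)
                                     (trans (sym (joinAll-partner wf q)) (source s))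
      where
      solve : ∀ x {y} → x ∨ y ≡ true → x ∧ y ≡ x → y ≡ true
      solve true  _ p = p
      solve false p _ = p

    flipped-covers : Covers (tiles (flipped i o)) L
    flipped-covers {e} {f} r with proj₁ e ≟ i | proj₁ f ≟ i
    ... | yes refl | yes q    = contradiction (sym q) (apart r)
    ... | yes refl | no f≢i   = trans (cong (tiles (flipped i o) e ∨_)
                                   (trans (tiles-flipped-off o i f f≢i) (neighbour-true (inj₁ r)))) (∨-zeroʳ _)
    ... | no e≢i   | yes refl = cong (_∨ tiles (flipped i o) f)
                                   (trans (tiles-flipped-off o i e e≢i) (neighbour-true (inj₂ r)))
    ... | no e≢i   | no f≢i   = trans (cong₂ _∨_ (tiles-flipped-off o i e e≢i) (tiles-flipped-off o i f f≢i)) (cov r)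

    flipped-source : ∀ s → matched (flipped i o) (i , s) ≡ s ∈ᴾ otherPair (o i)
    flipped-source s with partner? L (i , s)
    ... | inj₁ free    = trans (joinAll-free {L = L} free) (tiles-flipped-on o i s)
    ... | inj₂ (h , q) = trans (joinAll-partner wf q) (trans (cong (_ ∧_)
                           (trans (tiles-flipped-off o i h (partner-apart q ∘ sym)) (neighbour-true q)))
                           (trans (∧-identityʳ _) (tiles-flipped-on o i s)))

  flipped-outside : ∀ o i {g} → (∀ s → ¬ (i , s) ≈ g) → matched (flipped i o) g ≡ matched o g
  flipped-outside o i {g} out with partner? L g
  ... | inj₁ free    = trans (joinAll-free {L = L} free) (trans (tiles-flipped-off o i g off)
                         (sym (joinAll-free {L = L} free)))
    where
    off : proj₁ g ≢ i
    off refl = out (proj₂ g) ε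
  ... | inj₂ (h , q) = trans (joinAll-partner wf q) (trans
                         (cong₂ _∧_ (tiles-flipped-off o i g off) (tiles-flipped-off o i h off′))
                         (sym (joinAll-partner wf q)))
    where
    off : proj₁ g ≢ i
    off refl = out (proj₂ g) ε
    off′ : proj₁ h ≢ i
    off′ refl = out (proj₂ h) (partner-≈ (swap q))

  module _ (o : Fin n → Pair) (cov : Covers (tiles o) L) (i : Fin n)
           (source : ∀ s → matched o (i , s) ≡ s ∈ᴾ o i)
           {member : TileSide n → Bool} (respects : ∀ {g h} → g ≈ h → member g ≡ member h)
           (target : ∀ s → member (i , s) ≡ s ∈ᴾ otherPair (o i))
           (outside : ∀ g → (∀ s → ¬ (i , s) ≈ g) → matched o g ≡ member g) where

    private
      onTile : ∀ {g} → proj₁ g ≡ i → matched (flipped i o) g ≡ member g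
      onTile {_ , s} refl = trans (flipped-source o cov i source s) (sym (target s))

    -- A side off tile `i` is either glued to it, and then `respects` carries the value over from
    -- the tile, or it is not, and then `outside` applies.
    flip-matched : ∀ g → matched (flipped i o) g ≡ member g
    flip-matched g with proj₁ g ≟ i | partner? L g
    ... | yes p | _         = onTile p
    ... | no ¬p | inj₁ free = trans (flipped-outside o i out) (outside g out)
      where
      out : ∀ s → ¬ (i , s) ≈ g
      out s c = ¬p (sym (cong proj₁ (free-class free (EqClosure.symmetric _ c))))
    ... | no ¬p | inj₂ (h , q) with proj₁ h ≟ i
    ...   | yes p = trans (joinAll-partner wf q) (trans (∧-comm (tiles (flipped i o) g) (tiles (flipped i o) h)) (trans (sym (joinAll-partner wf (swap q)))
                      (trans (onTile p) (respects (partner-≈ (swap q))))))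
    ...   | no ¬q = trans (flipped-outside o i out) (outside g out)
      where
      out : ∀ s → ¬ (i , s) ≈ g
      out s c with partner-class wf q (EqClosure.symmetric _ c)
      ... | inj₁ refl = ¬p refl
      ... | inj₂ refl = ¬q refl

  -- If both o and its flip at i satisfy the covering condition, then
  -- every side glued to tile i lies in its own tile matching.
  flippable : ∀ o i → Covers (tiles o) L → Covers (tiles (flipped i o)) L →
              ∀ s → matched o (i , s) ≡ s ∈ᴾ o i
  flippable o i cov cov′ s with partner? L (i , s)
  ... | inj₁ free    = joinAll-free {L = L} free
  ... | inj₂ (h , q) = trans (joinAll-partner wf q) (trans (cong (_ ∧_)
      (solve (tiles o (i , s)) (covers-partner {b = tiles o} cov q)
        (trans (sym (cong₂ _∨_ (trans (tiles-flipped-on o i s) (∈ᴾ-otherPair s (o i)))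
                               (tiles-flipped-off o i h (partner-apart q ∘ sym))))
               (covers-partner {b = tiles (flipped i o)} cov′ q)))) (∧-identityʳ _))
    where
    solve : ∀ x {y} → x ∨ y ≡ true → not x ∨ y ≡ true → y ≡ true
    solve true  _ p = p
    solve false p _ = p

-- The glueings of a loop graph

parity-suc : ∀ n → parity (ℕ.suc n) ≡ parity n ⁻¹
parity-suc n = sym (⁻¹-selfInverse (suc-homo-⁻¹ n))

northEast : Side → Bool
northEast N = true
northEast E = true
northEast S = false
northEast W = false

exit-northEast : ∀ st → northEast (exit st) ≡ true
exit-northEast right = refl
exit-northEast up    = refl

freeExit-northEast : ∀ st → northEast (freeExit st) ≡ true
freeExit-northEast right = refl
freeExit-northEast up    = refl

entry-northEast : ∀ st → northEast (entry st) ≡ false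
entry-northEast right = refl
entry-northEast up    = refl

freeEntry-northEast : ∀ st → northEast (freeEntry st) ≡ false
freeEntry-northEast right = refl
freeEntry-northEast up    = refl

northEast-≢ : ∀ {s t} → northEast s ≡ true → northEast t ≡ false → s ≢ t
northEast-≢ p q refl = contradiction (trans (sym p) q) λ ()

exit≢freeExit : ∀ st → exit st ≢ freeExit st
exit≢freeExit right ()
exit≢freeExit up    ()

entry≢freeEntry : ∀ st → entry st ≢ freeEntry st
entry≢freeEntry right ()
entry≢freeEntry up    ()

-- The exit and the entry of one step are opposite sides of a square, so `i` and `j` may be the same
-- tile, as they are at the end tiles of the snake.
exit-entry-disjoint : ∀ {n} {i j : Fin n} st {κ} → IsEnd (i , exit st) κ → ¬ IsEnd (j , entry st) κ
exit-entry-disjoint right (inj₁ refl) (inj₁ ())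
exit-entry-disjoint right (inj₁ refl) (inj₂ ())
exit-entry-disjoint right (inj₂ refl) (inj₁ ())
exit-entry-disjoint right (inj₂ refl) (inj₂ ())
exit-entry-disjoint up    (inj₁ refl) (inj₁ ())
exit-entry-disjoint up    (inj₁ refl) (inj₂ ())
exit-entry-disjoint up    (inj₂ refl) (inj₁ ())
exit-entry-disjoint up    (inj₂ refl) (inj₂ ())

-- The parity of the distance from the lower left corner of the first tile,
-- which colours the vertices of the snake graph, a planar grid graph.
colour : ∀ {n} → TileCorner n → Parity
colour (i , SW) = parity (toℕ i)
colour (i , NE) = parity (toℕ i)
colour (i , SE) = parity (toℕ i) ⁻¹
colour (i , NW) = parity (toℕ i) ⁻¹

colour-apex : ∀ {n} (e : TileSide n) → colour (apexOf e) ≡ parity (toℕ (proj₁ e))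
colour-apex (i , N) = refl
colour-apex (i , S) = refl
colour-apex (i , E) = refl
colour-apex (i , W) = refl

colour-other : ∀ {n} (e : TileSide n) → colour (otherOf e) ≡ parity (toℕ (proj₁ e)) ⁻¹
colour-other (i , N) = refl
colour-other (i , S) = refl
colour-other (i , E) = refl
colour-other (i , W) = refl

⁻¹-≢ : ∀ p → p ≢ p ⁻¹
⁻¹-≢ 0ℙ ()
⁻¹-≢ 1ℙ ()

colour-ends : ∀ {n} (e : TileSide n) → colour (apexOf e) ≢ colour (otherOf e)
colour-ends e p = ⁻¹-≢ _ (trans (sym (colour-apex e)) (trans p (colour-other e)))

-- Glueing and cutting recurse over lists of pairs, whereas the snake and loop graphs are given by
-- relations with the same pairs.
transport : ∀ {n} {R R′ : Rel (TileSide n) 0ℓ} → (∀ {e f} → R e f → R′ e f) → (∀ {e f} → R′ e f → R e f) →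
            (P : PerfectMatching (glue R)) →
            ∃ λ (Q : PerfectMatching (glue R′)) → PerfectMatching.member Q ≡ PerfectMatching.member P
transport to from P = record
  { member   = member
  ; respects = respects ∘ EqClosure.map from
  ; perfect  = λ v → case perfect v of λ
      { (e , (m , inc) , uniq) → e , (m , map⊎ (EqClosure.map (corner to)) (EqClosure.map (corner to)) inc)
          , λ { (m′ , inc′) → EqClosure.map to (uniq (m′ , map⊎ (EqClosure.map (corner from)) (EqClosure.map (corner from)) inc′)) } }
  } , refl
  where
  open PerfectMatching P
  corner : ∀ {R R′ : Rel (TileSide _) 0ℓ} → (∀ {e f} → R e f → R′ e f) → ∀ {u v} → CornerGlueing R u v → CornerGlueing R′ u v
  corner f (apex-other r) = apex-other (f r)
  corner f (other-apex r) = other-apex (f r)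

-- The argument witnesses that the word has a letter.
lastLetter firstLetter : ∀ {k} → Fin k → Fin k
lastLetter  {ℕ.suc k} _ = fromℕ k
firstLetter {ℕ.suc k} _ = zero

suc-lastLetter : ∀ {k} (i : Fin k) → suc (lastLetter i) ≡ fromℕ k
suc-lastLetter {ℕ.suc k} _ = refl

inject₁-firstLetter : ∀ {k} (i : Fin k) → inject₁ (firstLetter i) ≡ zero
inject₁-firstLetter {ℕ.suc k} _ = refl

last-unique : ∀ {k} (i : Fin k) {l : Fin k} → suc l ≡ fromℕ k → l ≡ lastLetter i
last-unique i p = suc-injective (trans p (sym (suc-lastLetter i)))

first-unique : ∀ {k} (i : Fin k) {l : Fin k} → inject₁ l ≡ zero → l ≡ firstLetter i
first-unique i p = inject₁-injective (trans p (sym (inject₁-firstLetter i)))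

tile-ends : ∀ {n} {e f : TileSide n} {x} → proj₁ e ≢ proj₁ f → IsEnd e x → ¬ IsEnd f x
tile-ends ¬p (inj₁ refl) (inj₁ p) = ¬p (cong proj₁ p)
tile-ends ¬p (inj₁ refl) (inj₂ p) = ¬p (cong proj₁ p)
tile-ends ¬p (inj₂ refl) (inj₁ p) = ¬p (cong proj₁ p)
tile-ends ¬p (inj₂ refl) (inj₂ p) = ¬p (cong proj₁ p)

fromDisjointEnds : ∀ {n} {L : Glueing n} {e : TileSide n} →
                   (∀ {g h κ} → (g , h) ∈ L → IsEnd e κ → ¬ IsEnd g κ × ¬ IsEnd h κ) →
                   ∀ {u v x} → CornerGlueing ⟦ L ⟧ u v → IsEnd e x → u ≢ x × v ≢ x
fromDisjointEnds d (apex-other r) p = (λ { refl → proj₁ (d r p) (inj₁ refl) }) , λ { refl → proj₂ (d r p) (inj₂ refl) }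
fromDisjointEnds d (other-apex r) p = (λ { refl → proj₁ (d r p) (inj₂ refl) }) , λ { refl → proj₂ (d r p) (inj₁ refl) }

inhabited? : ∀ k → ¬ Fin k ⊎ Fin k
inhabited? ℕ.zero    = inj₁ λ ()
inhabited? (ℕ.suc _) = inj₂ zero

module _ (w : Loopstring) where
  open Loopstring w

  adjacentPair rightPair leftPair : Fin m → TileSide n × TileSide n
  adjacentPair i = (inject₁ i , exit (step w i)) , (suc i , entry (step w i))
  rightPair i    = (fromℕ m , exit (step w (lastLetter i))) , (inject₁ i , freeExit (step w i))
  leftPair i     = (zero , entry (step w (firstLetter i))) , (suc i , freeEntry (step w i))

  inject₁≢suc : ∀ {i k : Fin m} → i Fin.≤ k → inject₁ i ≢ suc k
  inject₁≢suc {i} {k} i≤k p = ℕ.<⇒≢ (ℕ.s≤s i≤k) (trans (sym (toℕ-inject₁ i)) (cong toℕ p))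

  snakeList : List (Fin m) → Glueing n
  snakeList = map adjacentPair

  snake-colour : ∀ {is u v} → EqClosure (CornerGlueing ⟦ snakeList is ⟧) u v → colour u ≡ colour v
  snake-colour {is} = closure-invariant colour step-colour
    where
    step-colour : ∀ {u v} → CornerGlueing ⟦ snakeList is ⟧ u v → colour u ≡ colour v
    step-colour (apex-other {i} {s} {j} {t} r) with k , _ , refl ← ∈-map⁻ adjacentPair r =
      trans (colour-apex (i , s)) (trans (cong parity (toℕ-inject₁ k))
        (trans (sym (suc-homo-⁻¹ (toℕ k))) (sym (colour-other (j , t)))))
    step-colour (other-apex {i} {s} {j} {t} r) with k , _ , refl ← ∈-map⁻ adjacentPair r =
      trans (colour-other (i , s)) (trans (cong (_⁻¹ ∘ parity) (toℕ-inject₁ k))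
        (trans (sym (parity-suc (toℕ k))) (sym (colour-apex (j , t)))))

  module _ {i : Fin m} {is : List (Fin m)} (i< : All (i Fin.<_) is) where

    -- The snake is built backwards from its last tile: letter `i` attaches tile `inject₁ i` to the
    -- snake of the later tiles, and the glueings at later letters do not reach back to it.
    snake-untouched : ∀ {g h} → (g , h) ∈ snakeList is → proj₁ g ≢ inject₁ i × proj₁ h ≢ inject₁ i
    snake-untouched r with k , k∈is , refl ← ∈-map⁻ adjacentPair r =
      (λ p → <-irrefl (sym (inject₁-injective p)) (All.lookup i< k∈is)) ,
      (λ p → inject₁≢suc (ℕ.<⇒≤ (All.lookup i< k∈is)) (sym p))

    snake-attachable : Attachable (snakeList is) (proj₁ (adjacentPair i)) (proj₂ (adjacentPair i))
    snake-attachable = record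
      { privateEnds = λ
        { (apex-other r) p → off (proj₁ (snake-untouched r)) p , off (proj₂ (snake-untouched r)) p
        ; (other-apex r) p → off (proj₁ (snake-untouched r)) p , off (proj₂ (snake-untouched r)) p }
      ; fresh       = fresh
      ; disjoint    = λ { (inj₁ refl) (inj₁ p) → inject₁≢suc ℕ.≤-refl (cong proj₁ p)
                        ; (inj₁ refl) (inj₂ p) → inject₁≢suc ℕ.≤-refl (cong proj₁ p)
                        ; (inj₂ refl) (inj₁ p) → inject₁≢suc ℕ.≤-refl (cong proj₁ p)
                        ; (inj₂ refl) (inj₂ p) → inject₁≢suc ℕ.≤-refl (cong proj₁ p) }
      ; separate    = λ p → colour-ends (proj₂ (adjacentPair i)) (snake-colour {is} p)
      }
      where
      off : ∀ {u x} → proj₁ u ≢ inject₁ i → IsEnd (proj₁ (adjacentPair i)) x → u ≢ x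
      off ¬p (inj₁ refl) refl = ¬p refl
      off ¬p (inj₂ refl) refl = ¬p refl
      fresh : ∀ {g h} → (g , h) ∈ snakeList is → g ≢ proj₂ (adjacentPair i) × h ≢ proj₂ (adjacentPair i)
      fresh r with k , k∈is , refl ← ∈-map⁻ adjacentPair r =
        (λ p → northEast-≢ (exit-northEast (step w k)) (entry-northEast (step w i)) (cong proj₂ p)) ,
        (λ p → <-irrefl (sym (suc-injective (cong proj₁ p))) (All.lookup i< k∈is))

  snake-wellFormed : ∀ {is} → AllPairs Fin._<_ is → WellFormed (snakeList is)
  snake-wellFormed []        = []
  snake-wellFormed (i< ∷ <s) = snake-attachable i< ∷ snake-wellFormed <s

  snake-chain : ∀ {is} → AllPairs Fin._<_ is → Chain (snakeList is)
  snake-chain []        = []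
  snake-chain (i< ∷ <s) = link (snake-untouched i<) (λ p → inject₁≢suc ℕ.≤-refl (sym p)) (snake-chain <s)

  snake : Glueing n
  snake = snakeList (allFin m)

  increasing : AllPairs Fin._<_ (allFin m)
  increasing = tabulate⁺-< id

  ∈-snake : ∀ i → adjacentPair i ∈ snake
  ∈-snake i = ∈-map⁺ adjacentPair (∈-allFin i)

  -- Of two right loops, the earlier one would force the later one to be an arrow. So at most one
  -- pair has to be added to the snake for each end.
  rightLoop-unique : ∀ {i j} → RightLoop word i → RightLoop word j → i ≡ j
  rightLoop-unique {i} {j} (li , ri) (lj , rj) with <-cmp i j
  ... | tri≈ _ p _ = p
  ... | tri< p _ _ = case trans (sym (ri j p)) lj of λ ()
  ... | tri> _ _ p = case trans (sym (rj i p)) li of λ ()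

  leftLoop-unique : ∀ {i j} → LeftLoop word i → LeftLoop word j → i ≡ j
  leftLoop-unique {i} {j} (li , ri) (lj , rj) with <-cmp i j
  ... | tri≈ _ p _ = p
  ... | tri< p _ _ = case trans (sym (rj i p)) li of λ ()
  ... | tri> _ _ p = case trans (sym (ri j p)) lj of λ ()

  rightLoops : Glueing n
  rightLoops with any? (rightLoop? word)
  ... | yes (i , _) = rightPair i ∷ snake
  ... | no _        = snake

  loops : Glueing n
  loops with any? (leftLoop? word)
  ... | yes (i , _) = leftPair i ∷ rightLoops
  ... | no _        = rightLoops

  -- Mediates between the list `loops` and the relations `Adjacent` and `LoopGlueing`: the first and
  -- last letters are computed here instead of being characterised by equations.
  data Origin : TileSide n → TileSide n → Set where
    fromLetter : ∀ i → Origin (proj₁ (adjacentPair i)) (proj₂ (adjacentPair i))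
    fromRight  : ∀ i → RightLoop word i → Origin (proj₁ (rightPair i)) (proj₂ (rightPair i))
    fromLeft   : ∀ i → LeftLoop word i → Origin (proj₁ (leftPair i)) (proj₂ (leftPair i))

  snake-origin : ∀ {e f} → (e , f) ∈ snake → Adjacent w e f
  snake-origin r with k , _ , refl ← ∈-map⁻ adjacentPair r = adjacent k

  snake⊆rightLoops : ∀ {p} → p ∈ snake → p ∈ rightLoops
  snake⊆rightLoops r with any? (rightLoop? word)
  ... | yes _ = there r
  ... | no _  = r

  rightLoops⊆loops : ∀ {p} → p ∈ rightLoops → p ∈ loops
  rightLoops⊆loops r with any? (leftLoop? word)
  ... | yes _ = there r
  ... | no _  = r

  ∈-rightLoops : ∀ {i} → RightLoop word i → rightPair i ∈ rightLoops
  ∈-rightLoops {i} l with any? (rightLoop? word)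
  ... | yes (j , l′) = here (cong rightPair (rightLoop-unique l l′))
  ... | no ¬l        = contradiction (i , l) ¬l

  ∈-loops : ∀ {i} → LeftLoop word i → leftPair i ∈ loops
  ∈-loops {i} l with any? (leftLoop? word)
  ... | yes (j , l′) = here (cong leftPair (leftLoop-unique l l′))
  ... | no ¬l        = contradiction (i , l) ¬l

  rightLoops-origin : ∀ {e f} → (e , f) ∈ rightLoops → (e , f) ∈ snake ⊎ ∃ λ i → RightLoop word i × (e , f) ≡ rightPair i
  rightLoops-origin r with any? (rightLoop? word)
  rightLoops-origin r         | no _        = inj₁ r
  rightLoops-origin (here p)  | yes (i , l) = inj₂ (i , l , p)
  rightLoops-origin (there r) | yes _       = inj₁ r

  loops-origin : ∀ {e f} → (e , f) ∈ loops → (e , f) ∈ rightLoops ⊎ ∃ λ i → LeftLoop word i × (e , f) ≡ leftPair i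
  loops-origin r with any? (leftLoop? word)
  loops-origin r         | no _        = inj₁ r
  loops-origin (here p)  | yes (i , l) = inj₂ (i , l , p)
  loops-origin (there r) | yes _       = inj₁ r

  origin : ∀ {e f} → (e , f) ∈ loops → Origin e f
  origin r with loops-origin r
  ... | inj₂ (i , l , refl) = fromLeft i l
  ... | inj₁ r′ with rightLoops-origin r′
  ...   | inj₂ (i , l , refl) = fromRight i l
  ...   | inj₁ r″ with adjacent i ← snake-origin r″ = fromLetter i

  origin⁻ : ∀ {e f} → Origin e f → (e , f) ∈ loops
  origin⁻ (fromLetter i)  = rightLoops⊆loops (snake⊆rightLoops (∈-snake i))
  origin⁻ (fromRight i l) = rightLoops⊆loops (∈-rightLoops l)
  origin⁻ (fromLeft i l)  = ∈-loops l

  loopGlueing-origin : ∀ {e f} → LoopGlueing w e f → Origin e f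
  loopGlueing-origin (rightLoop {i} l p) with refl ← last-unique i p = fromRight i l
  loopGlueing-origin (leftLoop {i} l p) with refl ← first-unique i p = fromLeft i l

  glueing-origin : ∀ {e f} → (Adjacent w ∪ LoopGlueing w) e f → Origin e f
  glueing-origin (inj₁ (adjacent i)) = fromLetter i
  glueing-origin (inj₂ r)            = loopGlueing-origin r

  origin-glueing : ∀ {e f} → Origin e f → (Adjacent w ∪ LoopGlueing w) e f
  origin-glueing (fromLetter i)  = inj₁ (adjacent i)
  origin-glueing (fromRight i l) = inj₂ (rightLoop l (suc-lastLetter i))
  origin-glueing (fromLeft i l)  = inj₂ (leftLoop l (inject₁-firstLetter i))

  origin-apart : ∀ {e f} → Origin e f → proj₁ e ≢ proj₁ f
  origin-apart (fromLetter i)  = inject₁≢suc ℕ.≤-refl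
  origin-apart (fromRight i _) = fromℕ≢inject₁
  origin-apart (fromLeft i _)  = λ ()

  right-attachable : ∀ {i} → RightLoop word i → Attachable snake (proj₁ (rightPair i)) (proj₂ (rightPair i))
  right-attachable {i} l = record
    { privateEnds = fromDisjointEnds ends
    ; fresh       = fresh
    ; disjoint    = tile-ends fromℕ≢inject₁
    ; separate    = λ p → colour-ends (proj₂ (rightPair i)) (snake-colour {allFin m} p)
    }
    where
    ends : ∀ {g h κ} → (g , h) ∈ snake → IsEnd (proj₁ (rightPair i)) κ → ¬ IsEnd g κ × ¬ IsEnd h κ
    ends r p with adjacent k ← snake-origin r = tile-ends fromℕ≢inject₁ p , entry-disjoint
      where
      -- Within the snake the last tile is glued only along the entry side of the last letter,
      -- opposite to the side used by the loop.
      entry-disjoint : ¬ IsEnd (suc k , entry (step w k)) _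
      entry-disjoint q with suc k ≟ fromℕ m
      ... | no ¬eq = tile-ends (¬eq ∘ sym) p q
      ... | yes eq with refl ← last-unique i eq = exit-entry-disjoint (step w k) p q
    fresh : ∀ {g h} → (g , h) ∈ snake → g ≢ proj₂ (rightPair i) × h ≢ proj₂ (rightPair i)
    fresh r with adjacent k ← snake-origin r =
      exit-free , λ p → northEast-≢ (freeExit-northEast (step w i)) (entry-northEast (step w k)) (sym (cong proj₂ p))
      where
      exit-free : (inject₁ k , exit (step w k)) ≢ proj₂ (rightPair i)
      exit-free p with refl ← inject₁-injective (cong proj₁ p) = exit≢freeExit (step w k) (cong proj₂ p)

  rightLoops-wellFormed : WellFormed rightLoops
  rightLoops-wellFormed with any? (rightLoop? word)
  ... | yes (_ , l) = right-attachable l ∷ snake-wellFormed increasing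
  ... | no _        = snake-wellFormed increasing

  left-attachable : ∀ {i} → LeftLoop word i → Attachable rightLoops (proj₁ (leftPair i)) (proj₂ (leftPair i))
  left-attachable {i} l = record
    { privateEnds = fromDisjointEnds ends
    ; fresh       = fresh
    ; disjoint    = tile-ends λ ()
    ; separate    = separate
    }
    where
    ends : ∀ {g h κ} → (g , h) ∈ rightLoops → IsEnd (proj₁ (leftPair i)) κ → ¬ IsEnd g κ × ¬ IsEnd h κ
    ends r p with rightLoops-origin r
    -- As a loop letter is never the first one, a right loop does not involve the first tile.
    ... | inj₂ (j , l′ , refl) = tile-ends zero≢fromℕ p , tile-ends (λ q → notFirst j (proj₁ l′) (sym q)) p
      where
      zero≢fromℕ : zero ≢ fromℕ m
      zero≢fromℕ q = case trans q (sym (suc-lastLetter j)) of λ ()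
    ... | inj₁ r′ with adjacent k ← snake-origin r′ = exit-disjoint , tile-ends (λ ()) p
      where
      exit-disjoint : ¬ IsEnd (inject₁ k , exit (step w k)) _
      exit-disjoint q with inject₁ k ≟ zero
      ... | no ¬eq = tile-ends (¬eq ∘ sym) p q
      ... | yes eq with refl ← first-unique i eq = exit-entry-disjoint (step w k) q p
    fresh : ∀ {g h} → (g , h) ∈ rightLoops → g ≢ proj₂ (leftPair i) × h ≢ proj₂ (leftPair i)
    fresh r with rightLoops-origin r
    ... | inj₂ (j , _ , refl) =
      (λ p → northEast-≢ (exit-northEast (step w (lastLetter j))) (freeEntry-northEast (step w i)) (cong proj₂ p)) ,
      (λ p → northEast-≢ (freeExit-northEast (step w j)) (freeEntry-northEast (step w i)) (cong proj₂ p))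
    ... | inj₁ r′ with adjacent k ← snake-origin r′ =
      (λ p → northEast-≢ (exit-northEast (step w k)) (freeEntry-northEast (step w i)) (cong proj₂ p)) ,
      entry-free
      where
      entry-free : (suc k , entry (step w k)) ≢ proj₂ (leftPair i)
      entry-free p with refl ← suc-injective (cong proj₁ p) = entry≢freeEntry (step w k) (cong proj₂ p)
    separate : ¬ EqClosure (CornerGlueing ⟦ rightLoops ⟧) (apexOf (proj₂ (leftPair i))) (otherOf (proj₂ (leftPair i)))
    separate c with any? (rightLoop? word)
    ... | no _         = colour-ends (proj₂ (leftPair i)) (snake-colour {allFin m} c)
    -- The glueing of the right loop need not preserve colours. The path is therefore retracted to
    -- the snake by `ρ`, which fixes the ends of the side in question because tile `suc i` is not
    -- the last one.
    ... | yes (j , l′) = colour-ends (proj₂ (leftPair i)) (snake-colour {allFin m}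
          (subst₂ (EqClosure (CornerGlueing ⟦ snake ⟧)) (ρ-id (off (inj₁ refl))) (ρ-id (off (inj₂ refl))) (ρ-cong c)))
      where
      open Attach (right-attachable l′) using (ρ-id; ρ-cong)
      off : ∀ {x} → IsEnd (proj₂ (leftPair i)) x → ¬ IsEnd (proj₁ (rightPair j)) x
      off = tile-ends (notLast i (proj₁ l))

  loops-wellFormed : WellFormed loops
  loops-wellFormed with any? (leftLoop? word)
  ... | yes (_ , l) = left-attachable l ∷ rightLoops-wellFormed
  ... | no _        = rightLoops-wellFormed

-- Good matchings and tile states

module _ (w : Loopstring) where
  open Loopstring w
  open LoopMatching using (matching; good; member)

  -- Loops glue boundary sides of the snake graph. On these a snake matching shows the tile state
  -- itself, so the fields of `_ExtendsTo_` become statements about tile states.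
  loopGlueing-free : ∀ {e f} → LoopGlueing w e f → Free (snake w) e × Free (snake w) f
  loopGlueing-free (rightLoop {i} l p) with refl ← last-unique i p =
    Attach.freshᵉ (right-attachable w l) , Attachable.fresh (right-attachable w l)
  loopGlueing-free (leftLoop {i} l p) with refl ← first-unique i p =
    (λ r → Attach.freshᵉ (left-attachable w l) (snake⊆rightLoops w r)) ,
    (λ r → Attachable.fresh (left-attachable w l) (snake⊆rightLoops w r))

  partner-loops : ∀ {g h} → Partner (snake w) g h → Partner (loops w) g h
  partner-loops = map⊎ snake⊆ snake⊆
    where
    snake⊆ : ∀ {p} → p ∈ snake w → p ∈ loops w
    snake⊆ r = rightLoops⊆loops w (snake⊆rightLoops w r)

  glueing⁺ : ∀ {e f} → (e , f) ∈ loops w → Adjacent w e f ⊎ LoopGlueing w e f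
  glueing⁺ r = origin-glueing w (origin w r)

  glueing⁻ : ∀ {e f} → Adjacent w e f ⊎ LoopGlueing w e f → (e , f) ∈ loops w
  glueing⁻ r = origin⁻ w (glueing-origin w r)

  adjacent-snake : ∀ {e f} → Adjacent w e f → (e , f) ∈ snake w
  adjacent-snake (adjacent i) = ∈-snake w i

  snake-wf : WellFormed (snake w)
  snake-wf = snake-wellFormed w (increasing w)

  wf : WellFormed (loops w)
  wf = loops-wellFormed w

  unglued-agree : ∀ b {g} → (∀ f → ¬ LoopGlueing w g f × ¬ LoopGlueing w f g) →
                  joinAll (loops w) b g ≡ joinAll (snake w) b g
  unglued-agree b {g} unglued with partner? (snake w) g
  ... | inj₂ (h , p) = trans (joinAll-partner wf (partner-loops p)) (sym (joinAll-partner snake-wf p))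
  ... | inj₁ free    = trans (joinAll-free {L = loops w} free′) (sym (joinAll-free {L = snake w} free))
    where
    free′ : Free (loops w) g
    free′ r with glueing⁺ r
    ... | inj₁ a = free (adjacent-snake a)
    ... | inj₂ l = (λ { refl → proj₁ (unglued _) l }) , λ { refl → proj₂ (unglued _) l }

  Encodes : (Fin n → Pair) → LoopMatching w → Set
  Encodes o P = Covers (tiles o) (loops w) × ∀ g → member P g ≡ joinAll (loops w) (tiles o) g

  -- The snake matching required by `good` is glued from the same tile states, omitting the loop
  -- pairs.
  encode : ∀ o → Covers (tiles o) (loops w) → ∃ (Encodes o)
  encode o cov
    with P₀ , eq₀ ← glueAll wf cov (disjointTiles o)
    with P , eq ← transport glueing⁺ glueing⁻ P₀
    with Pˢ₀ , eqˢ₀ ← glueAll {b = tiles o} snake-wf (λ r → cov (glueing⁻ (inj₁ (snake-origin w r)))) (disjointTiles o)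
    with Pˢ , eqˢ ← transport (snake-origin w) adjacent-snake Pˢ₀
    = record { matching = P ; good = Pˢ , extends } , cov , member≡
    where
    open PerfectMatching using () renaming (member to memberᴾ)
    b = tiles o
    member≡ : ∀ g → memberᴾ P g ≡ joinAll (loops w) b g
    member≡ g = cong (λ f → f g) (trans eq eq₀)
    snakeMember≡ : ∀ g → memberᴾ Pˢ g ≡ joinAll (snake w) b g
    snakeMember≡ g = cong (λ f → f g) (trans eqˢ eqˢ₀)
    onLoop : ∀ {e f} → LoopGlueing w e f → memberᴾ Pˢ e ≡ b e × memberᴾ Pˢ f ≡ b f
    onLoop {e} {f} r = trans (snakeMember≡ e) (joinAll-free {L = snake w} (proj₁ (loopGlueing-free r)))
                     , trans (snakeMember≡ f) (joinAll-free {L = snake w} (proj₂ (loopGlueing-free r)))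
    extends : _ExtendsTo_ w P Pˢ
    extends = record
      { unglued = λ e u → trans (member≡ e) (trans (unglued-agree b u) (sym (snakeMember≡ e)))
      ; glued   = λ {e} {f} r → trans (member≡ e) (trans (joinAll-partner wf (inj₁ (glueing⁻ (inj₂ r))))
                                  (sym (cong₂ _∧_ (proj₁ (onLoop r)) (proj₂ (onLoop r)))))
      ; covered = λ {e} {f} r → trans (cong₂ _∨_ (proj₁ (onLoop r)) (proj₂ (onLoop r))) (cov (glueing⁻ (inj₂ r)))
      }

  -- Cutting the snake extension yields the tile states and the covering condition at its adjacent
  -- tiles; at the loops that condition is the field `covered`.
  decode : ∀ P → ∃ λ o → Encodes o P
  decode P with Pˢ , extends ← good P
    with Pˢ₀ , eqˢ₀ ← transport adjacent-snake (snake-origin w) Pˢ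
    with T , cov , eqˢ ← unglueAll snake-wf (snake-chain w (increasing w)) Pˢ₀
    = o , covers , member≡
    where
    open PerfectMatching using () renaming (member to memberᴾ)
    open _ExtendsTo_ extends
    o : Fin n → Pair
    o i = proj₁ (tilePair T i)
    b = tiles o
    T≗b : ∀ g → memberᴾ T g ≡ b g
    T≗b (i , s) = proj₂ (tilePair T i) s
    snakeMember≡ : ∀ g → memberᴾ Pˢ g ≡ joinAll (snake w) b g
    snakeMember≡ g = trans (cong (λ f → f g) (sym eqˢ₀)) (trans (eqˢ g) (joinAll-cong (snake w) T≗b g))
    onLoop : ∀ {e f} → LoopGlueing w e f → memberᴾ Pˢ e ≡ b e × memberᴾ Pˢ f ≡ b f
    onLoop {e} {f} r = trans (snakeMember≡ e) (joinAll-free {L = snake w} (proj₁ (loopGlueing-free r)))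
                     , trans (snakeMember≡ f) (joinAll-free {L = snake w} (proj₂ (loopGlueing-free r)))
    covers : Covers b (loops w)
    covers {e} {f} r with glueing⁺ r
    ... | inj₁ a = trans (sym (cong₂ _∨_ (T≗b e) (T≗b f))) (cov (adjacent-snake a))
    ... | inj₂ l = trans (sym (cong₂ _∨_ (proj₁ (onLoop l)) (proj₂ (onLoop l)))) (covered l)
    onGlued : ∀ {e f} → LoopGlueing w e f → member P e ≡ b e ∧ b f
    onGlued r = trans (glued r) (cong₂ _∧_ (proj₁ (onLoop r)) (proj₂ (onLoop r)))
    unglued≡ : ∀ g → (∀ f → ¬ LoopGlueing w g f × ¬ LoopGlueing w f g) → member P g ≡ joinAll (loops w) b g
    unglued≡ g u = trans (unglued g u) (trans (snakeMember≡ g) (sym (unglued-agree b u)))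
    member≡ : ∀ g → member P g ≡ joinAll (loops w) b g
    member≡ g with partner? (loops w) g
    ... | inj₁ free = unglued≡ g λ f → (λ l → proj₁ (free (glueing⁻ (inj₂ l))) refl) , (λ l → proj₂ (free (glueing⁻ (inj₂ l))) refl)
    ... | inj₂ (h , inj₁ r) with glueing⁺ r
    ...   | inj₂ l = trans (onGlued l) (sym (joinAll-partner wf (inj₁ r)))
    ...   | inj₁ a = unglued≡ g λ f → (λ l → proj₁ (proj₁ (loopGlueing-free l) (adjacent-snake a)) refl)
                                    , (λ l → proj₁ (proj₂ (loopGlueing-free l) (adjacent-snake a)) refl)
    member≡ g | inj₂ (h , inj₂ r) with glueing⁺ r
    ...   | inj₂ l = trans (sym (PerfectMatching.respects (matching P) (EqClosure.return (inj₂ l))))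
                     (trans (onGlued l) (trans (∧-comm (b h) (b g)) (sym (joinAll-partner wf (inj₂ r)))))
    ...   | inj₁ a = unglued≡ g λ f → (λ l → proj₂ (proj₁ (loopGlueing-free l) (adjacent-snake a)) refl)
                                    , (λ l → proj₂ (proj₂ (loopGlueing-free l) (adjacent-snake a)) refl)

  -- On the last tile, glueings use at most the exit and the entry side of the last letter. A left
  -- loop would use a further S or W side only if its letter were the last one.
  last-freeSide : ∃ λ s → Free (loops w) (fromℕ m , s)
  last-freeSide with inhabited? m
  -- A single tile has no glueings, so any side will do.
  ... | inj₁ ¬i = N , λ r → case origin w r of λ
    { (fromLetter i)  → contradiction i ¬i
    ; (fromRight i _) → contradiction i ¬i
    ; (fromLeft i _)  → contradiction i ¬i }
  ... | inj₂ z = freeEntry st , λ r → free (origin w r)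
    where
    st = step w (lastLetter z)
    free : ∀ {e f} → Origin w e f → e ≢ (fromℕ m , freeEntry st) × f ≢ (fromℕ m , freeEntry st)
    free (fromLetter i) =
      (λ p → northEast-≢ (exit-northEast (step w i)) (freeEntry-northEast st) (cong proj₂ p)) , entry-free
      where
      entry-free : (suc i , entry (step w i)) ≢ (fromℕ m , freeEntry st)
      entry-free p with refl ← last-unique z (cong proj₁ p) = entry≢freeEntry st (cong proj₂ p)
    free (fromRight i _) =
      (λ p → northEast-≢ (exit-northEast (step w (lastLetter i))) (freeEntry-northEast st) (cong proj₂ p)) ,
      (λ p → northEast-≢ (freeExit-northEast (step w i)) (freeEntry-northEast st) (cong proj₂ p))
    free (fromLeft i l) =
      (λ p → case trans (cong proj₁ p) (sym (suc-lastLetter i)) of λ ()) ,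
      (λ p → notLast i (proj₁ l) (cong proj₁ p))

  -- Starts at the free side of the last tile and goes backwards: once the state of tile `suc i` is
  -- known, `∧-∨-determined` cancels its side from the conjunction at letter `i`.
  determined : ∀ {o o′} → Covers (tiles o) (loops w) → Covers (tiles o′) (loops w) →
               (∀ g → joinAll (loops w) (tiles o) g ≡ joinAll (loops w) (tiles o′) g) → ∀ i → o i ≡ o′ i
  determined {o} {o′} cov cov′ eq = >-weakInduction (λ i → o i ≡ o′ i) top down
    where
    top : o (fromℕ m) ≡ o′ (fromℕ m)
    top with s , free ← last-freeSide = ∈ᴾ-injective s
      (trans (sym (joinAll-free {L = loops w} free)) (trans (eq _) (joinAll-free {L = loops w} free)))
    down : ∀ i → o (suc i) ≡ o′ (suc i) → o (inject₁ i) ≡ o′ (inject₁ i)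
    down i p = ∈ᴾ-injective (exit (step w i)) (∧-∨-determined _ _ (b f)
        (cov r) (trans (cong (b′ e ∨_) bf) (cov′ r))
        (trans (sym (joinAll-partner wf (inj₁ r))) (trans (eq e)
          (trans (joinAll-partner wf (inj₁ r)) (cong (b′ e ∧_) (sym bf))))))
      where
      b = tiles o
      b′ = tiles o′
      e = proj₁ (adjacentPair w i)
      f = proj₂ (adjacentPair w i)
      r : (e , f) ∈ loops w
      r = glueing⁻ (inj₁ (adjacent i))
      bf : b f ≡ b′ f
      bf = cong (proj₂ f ∈ᴾ_) p

-- Covering conditions as implications

raise : Bool → Pair → Pair
raise true  o = otherPair o
raise false o = o

∈ᴾ-raise : ∀ s x o → s ∈ᴾ raise x o ≡ x xor (s ∈ᴾ o)
∈ᴾ-raise s true  o = ∈ᴾ-otherPair s o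
∈ᴾ-raise s false o = refl

raise-injective : ∀ {x y} o → raise x o ≡ raise y o → x ≡ y
raise-injective {true}  {true}  _ _ = refl
raise-injective {false} {false} _ _ = refl
raise-injective {true}  {false} horizontal ()
raise-injective {true}  {false} vertical   ()
raise-injective {false} {true}  horizontal ()
raise-injective {false} {true}  vertical   ()

otherPair-raise : ∀ x o → otherPair (raise x o) ≡ raise (not x) o
otherPair-raise true  o = otherPair-involutive o
otherPair-raise false o = refl

raised : Pair → Pair → Bool
raised horizontal horizontal = false
raised horizontal vertical   = true
raised vertical   horizontal = true
raised vertical   vertical   = false

raise-raised : ∀ o p → raise (raised o p) o ≡ p
raise-raised horizontal horizontal = refl
raise-raised horizontal vertical   = refl
raise-raised vertical   horizontal = refl
raise-raised vertical   vertical   = refl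

orientation : ∀ {n} → Subset n → Fin n → Pair
orientation X i = raise (lookup X i) (lowerPair i)

low : Parity → Pair
low 1ℙ = vertical
low 0ℙ = horizontal

lowerPair-low : ∀ {n} (i : Fin n) → lowerPair i ≡ low (parity (ℕ.suc (toℕ i)))
lowerPair-low i with parity (ℕ.suc (toℕ i))
... | 1ℙ = refl
... | 0ℙ = refl

isDirect : Direction → Bool
isDirect direct  = true
isDirect inverse = false

isDirect-opposite : ∀ d → isDirect (opposite d) ≡ not (isDirect d)
isDirect-opposite direct  = refl
isDirect-opposite inverse = refl

-- `nextTile` and `low` alternate with the same parity, which cancels: only the direction of the
-- letter remains. This is why covering conditions turn into implications along the arrows,
-- independently of the position.
exit-low : ∀ p d → exit (nextTile p d) ∈ᴾ low p ≡ isDirect d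
exit-low 1ℙ direct  = refl
exit-low 1ℙ inverse = refl
exit-low 0ℙ direct  = refl
exit-low 0ℙ inverse = refl

freeExit-exit : ∀ st o → freeExit st ∈ᴾ o ≡ not (exit st ∈ᴾ o)
freeExit-exit right horizontal = refl
freeExit-exit right vertical   = refl
freeExit-exit up    horizontal = refl
freeExit-exit up    vertical   = refl

entry-exit : ∀ st o → entry st ∈ᴾ o ≡ exit st ∈ᴾ o
entry-exit right horizontal = refl
entry-exit right vertical   = refl
entry-exit up    horizontal = refl
entry-exit up    vertical   = refl

freeEntry-entry : ∀ st o → freeEntry st ∈ᴾ o ≡ not (entry st ∈ᴾ o)
freeEntry-entry right horizontal = refl
freeEntry-entry right vertical   = refl
freeEntry-entry up    horizontal = refl
freeEntry-entry up    vertical   = refl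

low-⁻¹ : ∀ p → low (p ⁻¹) ≡ otherPair (low p)
low-⁻¹ 1ℙ = refl
low-⁻¹ 0ℙ = refl

orient-opposite : ∀ {A : Set} d (x y : A) → orient (opposite d) x y ≡ orient d y x
orient-opposite direct  x y = refl
orient-opposite inverse x y = refl

-- `x xor isDirect d` is the membership of a side that the lower state contains exactly when `d` is
-- direct. The disjunction is thus the clause form of the implication.
covering⇒implication : ∀ d {x y} → (x xor isDirect d) ∨ (y xor not (isDirect d)) ≡ true →
                       proj₁ (orient d x y) ≡ true → proj₂ (orient d x y) ≡ true
covering⇒implication direct  {true}  {true}  _ _ = refl
covering⇒implication inverse {true}  {true}  _ _ = refl
covering⇒implication direct  {true}  {false} () _
covering⇒implication inverse {true}  {false} _ ()
covering⇒implication direct  {false} {_}     _ ()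
covering⇒implication inverse {false} {true}  () _
covering⇒implication inverse {false} {false} _ ()

implication⇒covering : ∀ d {x y} → (proj₁ (orient d x y) ≡ true → proj₂ (orient d x y) ≡ true) →
                       (x xor isDirect d) ∨ (y xor not (isDirect d)) ≡ true
implication⇒covering direct  {true}  {true}  _ = refl
implication⇒covering direct  {true}  {false} h = h refl
implication⇒covering direct  {false} {_}     _ = refl
implication⇒covering inverse {true}  {_}     _ = refl
implication⇒covering inverse {false} {true}  h = h refl
implication⇒covering inverse {false} {false} _ = refl

lookup-orient : ∀ {n} (X : Subset n) d i j →
                (lookup X (proj₁ (orient d i j)) , lookup X (proj₂ (orient d i j))) ≡
                orient d (lookup X i) (lookup X j)
lookup-orient X direct  i j = refl
lookup-orient X inverse i j = refl

module _ {n} (X : Subset n) {i j : Fin n} {s t : Side} where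

  private
    value : ∀ {k r x} → r ∈ᴾ lowerPair k ≡ x → tiles (orientation X) (k , r) ≡ lookup X k xor x
    value {k} {r} eq = trans (∈ᴾ-raise r (lookup X k) (lowerPair k)) (cong (lookup X k xor_) eq)

  covering⇒closed : ∀ d → s ∈ᴾ lowerPair i ≡ isDirect d → t ∈ᴾ lowerPair j ≡ not (isDirect d) →
                    tiles (orientation X) (i , s) ∨ tiles (orientation X) (j , t) ≡ true →
                    lookup X (proj₁ (orient d i j)) ≡ true → lookup X (proj₂ (orient d i j)) ≡ true
  covering⇒closed d p q c h = trans (cong proj₂ (lookup-orient X d i j))
    (covering⇒implication d (trans (sym (cong₂ _∨_ (value p) (value q))) c)
      (trans (sym (cong proj₁ (lookup-orient X d i j))) h))

  closed⇒covering : ∀ d → s ∈ᴾ lowerPair i ≡ isDirect d → t ∈ᴾ lowerPair j ≡ not (isDirect d) →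
                    (lookup X (proj₁ (orient d i j)) ≡ true → lookup X (proj₂ (orient d i j)) ≡ true) →
                    tiles (orientation X) (i , s) ∨ tiles (orientation X) (j , t) ≡ true
  closed⇒covering d p q c = trans (cong₂ _∨_ (value p) (value q)) (implication⇒covering d λ h →
    trans (sym (cong proj₂ (lookup-orient X d i j))) (c (trans (cong proj₁ (lookup-orient X d i j)) h)))

-- Acyclicity of M(w)

-- With equal weights, a loop letter separated from the end of the word by a single arrow would give
-- its additional connection two end points of equal potential.
weight : Letter → ℕ
weight (arrow _) = 2
weight (loop _)  = 1

weightIn : Direction → Letter → ℕ
weightIn d l = if does (direction l ≟ᴰ d) then weight l else 0

-- The weight of the letters of direction d after a position plus that of
-- the letters of the other direction before it.
potential : Direction → ∀ {m} → Vec Letter m → Fin (ℕ.suc m) → ℕ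
potential d []      zero    = 0
potential d (l ∷ u) zero    = weightIn d l + potential d u zero
potential d (l ∷ u) (suc i) = weightIn (opposite d) l + potential d u i

-- At any position each letter counts in exactly one of the two potentials, so their sum is the
-- total weight. Hence a drop of the inverse potential is a rise of the direct one.
potential-total : ∀ {m} (u : Vec Letter m) i j →
                  potential direct u i + potential inverse u i ≡ potential direct u j + potential inverse u j
potential-total u i j = trans (total u i) (sym (total u j))
  where
  exchange : ∀ x y z → x + (y + z) ≡ y + (x + z)
  exchange x y z = trans (sym (ℕ.+-assoc x y z)) (trans (cong (_+ z) (ℕ.+-comm x y)) (ℕ.+-assoc y x z))
  total : ∀ {m} (u : Vec Letter m) i → potential direct u i + potential inverse u i ≡ Vec.sum (Vec.map weight u)
  total []              zero    = refl
  total (l ∷ u) zero with direction l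
  ... | direct  = trans (ℕ.+-assoc (weight l) _ _) (cong (weight l +_) (total u zero))
  ... | inverse = trans (exchange (potential direct u zero) (weight l) _) (cong (weight l +_) (total u zero))
  total (l ∷ u) (suc i) with direction l
  ... | inverse = trans (ℕ.+-assoc (weight l) _ _) (cong (weight l +_) (total u i))
  ... | direct  = trans (exchange (potential direct u i) (weight l) _) (cong (weight l +_) (total u i))

potential-orient : ∀ d {m} (u : Vec Letter m) {i j} → potential d u j ℕ.< potential d u i →
                   potential direct u (proj₂ (orient d i j)) ℕ.< potential direct u (proj₁ (orient d i j))
potential-orient direct  u p = p
potential-orient inverse u {i} {j} p = ℕ.+-cancelʳ-< (potential inverse u j) _ _
  (ℕ.<-≤-trans (ℕ.+-monoʳ-< (potential direct u i) p) (ℕ.≤-reflexive (potential-total u i j)))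

weight>0 : ∀ l → 0 ℕ.< weight l
weight>0 (arrow _) = ℕ.z<s
weight>0 (loop _)  = ℕ.z<s

weightIn-same : ∀ {d} l → direction l ≡ d → weightIn d l ≡ weight l × weightIn (opposite d) l ≡ 0
weightIn-same {direct}  (arrow direct)  refl = refl , refl
weightIn-same {direct}  (loop direct)   refl = refl , refl
weightIn-same {inverse} (arrow inverse) refl = refl , refl
weightIn-same {inverse} (loop inverse)  refl = refl , refl

weightIn-arrow : ∀ d → weightIn d (arrow (opposite d)) ≡ 0 × weightIn (opposite d) (arrow (opposite d)) ≡ 2
weightIn-arrow direct  = refl , refl
weightIn-arrow inverse = refl , refl

potential-letter : ∀ {d m} (u : Vec Letter m) i → direction (lookup u i) ≡ d →
                   potential d u (suc i) ℕ.< potential d u (inject₁ i)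
potential-letter (l ∷ u) zero p
  rewrite proj₁ (weightIn-same l p) | proj₂ (weightIn-same l p) = ℕ.+-monoˡ-< (potential _ u zero) (weight>0 l)
potential-letter (l ∷ u) (suc i) p = ℕ.+-monoʳ-< (weightIn _ l) (potential-letter u i p)

-- A loop letter weighs less than an arrow, hence is outweighed by any
-- arrow that it is followed or preceded by.
potential-left : ∀ {d m} (u : Vec Letter m) i → lookup u i ≡ loop d →
                 (∀ j → j Fin.< i → lookup u j ≡ arrow (opposite d)) → inject₁ i ≢ zero →
                 potential d u zero ℕ.< potential d u (suc i)
potential-left u zero p h i≢0 = contradiction refl i≢0
potential-left {d} (l ∷ u) (suc i) p h _ with refl ← h zero ℕ.z<s
  rewrite proj₁ (weightIn-arrow d) | proj₂ (weightIn-arrow d) = ℕ.s≤s (weak u i p λ j j<i → h (suc j) (ℕ.s<s j<i))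
  where
  weak : ∀ {m} (u : Vec Letter m) i → lookup u i ≡ loop d →
         (∀ j → j Fin.< i → lookup u j ≡ arrow (opposite d)) →
         potential d u zero ℕ.≤ ℕ.suc (potential d u (suc i))
  weak (_ ∷ u) zero refl h rewrite proj₁ (weightIn-same {d} (loop d) refl) | proj₂ (weightIn-same {d} (loop d) refl) = ℕ.≤-refl
  weak (l ∷ u) (suc i) p h with refl ← h zero ℕ.z<s
    rewrite proj₁ (weightIn-arrow d) | proj₂ (weightIn-arrow d) =
    ℕ.m≤n⇒m≤1+n (ℕ.m≤n⇒m≤1+n (weak u i p λ j j<i → h (suc j) (ℕ.s<s j<i)))

potential-right : ∀ {d m} (u : Vec Letter m) i → lookup u i ≡ loop d →
                  (∀ j → i Fin.< j → lookup u j ≡ arrow (opposite d)) → suc i ≢ fromℕ m →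
                  potential d u (inject₁ i) ℕ.< potential d u (fromℕ m)
potential-right (l ∷ u) (suc i) p h i≢m =
  ℕ.+-monoʳ-< (weightIn _ l) (potential-right u i p (λ j i<j → h (suc j) (ℕ.s<s i<j)) (i≢m ∘ cong suc))
potential-right (_ ∷ []) zero p h i≢m = contradiction refl i≢m
potential-right {d} (_ ∷ l ∷ u) zero refl h i≢m with refl ← h (suc zero) ℕ.z<s
  rewrite proj₁ (weightIn-arrow d) | proj₂ (weightIn-arrow d)
        | proj₁ (weightIn-same {d} (loop d) refl) | proj₂ (weightIn-same {d} (loop d) refl) =
  ℕ.s≤s (ℕ.s≤s (weak u λ j → h (suc (suc j)) ℕ.z<s))
  where
  weak : ∀ {m} (u : Vec Letter m) → (∀ j → lookup u j ≡ arrow (opposite d)) →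
         potential d u zero ℕ.≤ potential d u (fromℕ m)
  weak []      h = ℕ.≤-refl
  weak (l ∷ u) h with refl ← h zero rewrite proj₁ (weightIn-arrow d) | proj₂ (weightIn-arrow d) =
    ℕ.m≤n⇒m≤1+n (ℕ.m≤n⇒m≤1+n (weak u (h ∘ suc)))

module _ (w : Loopstring) where
  open Loopstring w
  open LoopMatching using (matching; member)

  rank : Fin n → ℕ
  rank = potential direct word

  rank-decreasing : ∀ c → rank (end w c) ℕ.< rank (start w c)
  rank-decreasing (byLetter i)  = potential-orient (direction (letter i)) word (potential-letter word i refl)
  rank-decreasing (byLeft i l)  = case recompute (leftLoop? word i) l of λ
    { (p , h) → potential-orient (direction (letter i)) word (potential-left word i p h (notFirst i p)) }
  rank-decreasing (byRight i r) = case recompute (rightLoop? word i) r of λ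
    { (p , h) → potential-orient (direction (letter i)) word (potential-right word i p h (notLast i p)) }

  Closed : Subset n → Set
  Closed X = ∀ c → lookup X (start w c) ≡ true → lookup X (end w c) ≡ true

  exit-value : ∀ i → exit (step w i) ∈ᴾ lowerPair (inject₁ i) ≡ isDirect (direction (letter i))
  exit-value i = trans (cong (exit (step w i) ∈ᴾ_) (trans (lowerPair-low (inject₁ i))
                         (cong (low ∘ parity ∘ ℕ.suc) (toℕ-inject₁ i))))
                       (exit-low (parity (ℕ.suc (toℕ i))) (direction (letter i)))

  freeExit-value : ∀ i → freeExit (step w i) ∈ᴾ lowerPair (inject₁ i) ≡ not (isDirect (direction (letter i)))
  freeExit-value i = trans (freeExit-exit (step w i) (lowerPair (inject₁ i))) (cong not (exit-value i))

  exit-value-suc : ∀ i → exit (step w i) ∈ᴾ lowerPair (suc i) ≡ not (isDirect (direction (letter i)))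
  exit-value-suc i = trans (cong (exit (step w i) ∈ᴾ_) (trans (lowerPair-low (suc i))
      (trans (cong low (parity-suc (ℕ.suc (toℕ i)))) (low-⁻¹ (parity (ℕ.suc (toℕ i)))))))
    (trans (∈ᴾ-otherPair (exit (step w i)) (low (parity (ℕ.suc (toℕ i)))))
      (cong not (exit-low (parity (ℕ.suc (toℕ i))) (direction (letter i)))))

  entry-value : ∀ i → entry (step w i) ∈ᴾ lowerPair (suc i) ≡ not (isDirect (direction (letter i)))
  entry-value i = trans (entry-exit (step w i) (lowerPair (suc i))) (exit-value-suc i)

  freeEntry-value : ∀ i → freeEntry (step w i) ∈ᴾ lowerPair (suc i) ≡ isDirect (direction (letter i))
  freeEntry-value i = trans (freeEntry-entry (step w i) (lowerPair (suc i)))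
    (trans (cong not (entry-value i)) (not-involutive _))

  -- Two negations cancel: the last letter is opposite to the loop letter, and its exit side is
  -- taken on the tile after it, where the lower pair is the other one.
  last-value : ∀ {i} → RightLoop word i →
               exit (step w (lastLetter i)) ∈ᴾ lowerPair (fromℕ m) ≡ isDirect (direction (letter i))
  last-value {i} (p , h) = trans
    (cong (λ k → exit (step w l) ∈ᴾ lowerPair k) (sym (suc-lastLetter i)))
    (trans (exit-value-suc l) (trans (cong (not ∘ isDirect ∘ direction) (h l (i<l (notLast i p))))
      (trans (cong not (isDirect-opposite (direction (letter i)))) (not-involutive _))))
    where
    l = lastLetter i
    i<l : ∀ {k} {i : Fin k} → suc i ≢ fromℕ k → i Fin.< lastLetter i
    i<l {ℕ.suc k} {i} i≢ = ≤∧≢⇒< (≤fromℕ i) (i≢ ∘ cong suc)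

  first-value : ∀ {i} → LeftLoop word i →
                entry (step w (firstLetter i)) ∈ᴾ lowerPair {n} zero ≡ isDirect (opposite (direction (letter i)))
  first-value {i} (p , h) = trans
    (cong (λ k → entry (step w f) ∈ᴾ lowerPair k) (sym (inject₁-firstLetter i)))
    (trans (entry-exit (step w f) (lowerPair (inject₁ f)))
      (trans (exit-value f) (cong (isDirect ∘ direction) (h f (f<i (notFirst i p))))))
    where
    f = firstLetter i
    f<i : ∀ {k} {i : Fin k} → inject₁ i ≢ zero → firstLetter i Fin.< i
    f<i {i = zero}  i≢ = contradiction refl i≢
    f<i {i = suc _} i≢ = ℕ.z<s

  second-value : ∀ i → freeEntry (step w i) ∈ᴾ lowerPair (suc i) ≡ not (isDirect (opposite (direction (letter i))))
  second-value i = trans (freeEntry-value i) (trans (sym (not-involutive _))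
    (cong not (sym (isDirect-opposite (direction (letter i))))))

  closed-covers : ∀ {X} → Closed X → Covers (tiles (orientation X)) (loops w)
  closed-covers {X} cl r with origin w r
  ... | fromLetter i  = closed⇒covering X (direction (letter i)) (exit-value i) (entry-value i) (cl (byLetter i))
  ... | fromRight i l = closed⇒covering X (direction (letter i)) (last-value l) (freeExit-value i) (cl (byRight i l))
  -- The glueing lists the first tile before tile `suc i`, the connection `byLeft` lists them the
  -- other way round; hence the opposite direction.
  ... | fromLeft i l  = closed⇒covering X (opposite (direction (letter i))) (first-value l) (second-value i)
      (subst (λ p → lookup X (proj₁ p) ≡ true → lookup X (proj₂ p) ≡ true)
             (sym (orient-opposite (direction (letter i)) zero (suc i))) (cl (byLeft i l)))

  covers-closed : ∀ {X} → Covers (tiles (orientation X)) (loops w) → Closed X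
  covers-closed {X} cov (byLetter i) =
    covering⇒closed X (direction (letter i)) (exit-value i) (entry-value i) (cov (origin⁻ w (fromLetter i)))
  covers-closed {X} cov (byRight i r) =
    covering⇒closed X (direction (letter i)) (last-value l) (freeExit-value i) (cov (origin⁻ w (fromRight i l)))
    where
    l = recompute (rightLoop? word i) r
  covers-closed {X} cov (byLeft i r) =
    subst (λ p → lookup X (proj₁ p) ≡ true → lookup X (proj₂ p) ≡ true)
      (orient-opposite (direction (letter i)) zero (suc i))
      (covering⇒closed X (opposite (direction (letter i))) (first-value l) (second-value i) (cov (origin⁻ w (fromLeft i l))))
    where
    l = recompute (leftLoop? word i) r

-- Flips and the order

lookup-injective : ∀ {n} {X Y : Subset n} → (∀ i → lookup X i ≡ lookup Y i) → X ≡ Y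
lookup-injective {X = X} {Y} eq = trans (sym (tabulate∘lookup X)) (trans (tabulate-cong eq) (tabulate∘lookup Y))

infix 4 _⊑_
_⊑_ : ∀ {n} → Subset n → Subset n → Set
X ⊑ Y = ∀ i → lookup X i ≡ true → lookup Y i ≡ true

⊑-insert : ∀ {n} (X : Subset n) j → X ⊑ X [ j ]≔ true
⊑-insert X j k p with k ≟ j
... | yes refl = lookup∘update j X true
... | no k≢j   = trans (lookup∘update′ k≢j X true) p

module _ (w : Loopstring) where
  open Loopstring w
  open LoopMatching using (matching; member)
  open Flips (loops-wellFormed w) (λ r → origin-apart w (origin w r))

  -- A record, since `X` could not be inferred from the unfolded `Encodes`.
  record Represents (X : Subset n) (P : LoopMatching w) : Set where
    constructor ⟨_⟩
    field
      encodes : Encodes w (orientation X) P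

  represents : ∀ P → ∃ λ X → Represents X P
  represents P with o , cov , eq ← decode w P =
    X , ⟨ (λ {e} {f} r → trans (cong₂ _∨_ (tiles≡ e) (tiles≡ f)) (cov r))
        , (λ g → trans (eq g) (sym (joinAll-cong (loops w) tiles≡ g))) ⟩
    where
    X : Subset n
    X = tabulate λ i → raised (lowerPair i) (o i)
    tiles≡ : ∀ g → tiles (orientation X) g ≡ tiles o g
    tiles≡ (i , s) = cong (s ∈ᴾ_) (trans (cong (λ x → raise x (lowerPair i)) (lookup∘tabulate (λ i → raised (lowerPair i) (o i)) i))
                                         (raise-raised (lowerPair i) (o i)))

  represents-closed : ∀ {X P} → Represents X P → Closed w X
  represents-closed {X} ⟨ cov , _ ⟩ = covers-closed w {X} cov

  closed-represents : ∀ {X} → Closed w X → ∃ (Represents X)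
  closed-represents {X} cl = map₂ ⟨_⟩ (encode w (orientation X) (closed-covers w {X} cl))

  represents-injective : ∀ {X Y P Q} → Represents X P → Represents Y Q →
                         (∀ g → member P g ≡ member Q g) → X ≡ Y
  represents-injective {X} {Y} ⟨ cov , eq ⟩ ⟨ cov′ , eq′ ⟩ P≈Q = lookup-injective λ i →
    raise-injective {lookup X i} {lookup Y i} (lowerPair i) (determined w cov cov′ (λ g → trans (sym (eq g)) (trans (P≈Q g) (eq′ g))) i)

  represents-≈ : ∀ {X P Q} → Represents X P → Represents X Q → ∀ g → member P g ≡ member Q g
  represents-≈ ⟨ _ , eq ⟩ ⟨ _ , eq′ ⟩ g = trans (eq g) (sym (eq′ g))

  ≈⇒glued : ∀ {g h} → EqClosure ⟦ loops w ⟧ g h → Graph._≈ᴱ_ (loopGraph w) g h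
  ≈⇒glued = EqClosure.map (glueing⁺ w)

  glued⇒≈ : ∀ {g h} → Graph._≈ᴱ_ (loopGraph w) g h → EqClosure ⟦ loops w ⟧ g h
  glued⇒≈ = EqClosure.map (glueing⁻ w)

  Toggles : Fin n → Subset n → Subset n → Set
  Toggles i X Y = lookup Y i ≡ not (lookup X i) × (∀ j → j ≢ i → lookup Y j ≡ lookup X j)

  flip-toggles : ∀ {X Y P Q i p} → Represents X P → Represents Y Q → Flip w i p P Q →
                 orientation X i ≡ p × Toggles i X Y
  flip-toggles {X} {Y} {P} {Q} {i} {p} ⟨ cov , eq ⟩ ⟨ cov′ , eq′ ⟩ F = at-i , toggled , away
    where
    open Flip F
    o : Fin n → Pair
    o = orientation X
    source′ : ∀ s → matched o (i , s) ≡ s ∈ᴾ p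
    source′ s = trans (sym (eq (i , s))) (source s)
    at-i : o i ≡ p
    at-i = matched-tile o source′
    onTile : ∀ s → matched o (i , s) ≡ s ∈ᴾ o i
    onTile s = trans (source′ s) (cong (s ∈ᴾ_) (sym at-i))
    flipped≡ : ∀ j → flipped i o j ≡ orientation Y j
    flipped≡ = determined w (flipped-covers o cov i onTile) cov′ λ g →
      trans (flip-matched o cov i onTile
              (λ c → PerfectMatching.respects (matching Q) (≈⇒glued c))
              (λ s → trans (target s) (cong (λ q → s ∈ᴾ otherPair q) (sym at-i)))
              (λ g out → trans (sym (eq g)) (outside g λ s c → out s (glued⇒≈ c))) g)
            (eq′ g)
    toggled : lookup Y i ≡ not (lookup X i)
    toggled = raise-injective (lowerPair i) (trans (sym (flipped≡ i))
      (trans (updateAt-updates i o) (otherPair-raise (lookup X i) (lowerPair i))))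
    away : ∀ j → j ≢ i → lookup Y j ≡ lookup X j
    away j j≢i = raise-injective (lowerPair j) (trans (sym (flipped≡ j)) (updateAt-minimal j i o j≢i))

  toggle-flips : ∀ {X Y P Q i} → Represents X P → Represents Y Q → Toggles i X Y →
                 Flip w i (orientation X i) P Q
  toggle-flips {X} {Y} {P} {Q} {i} ⟨ cov , eq ⟩ ⟨ cov′ , eq′ ⟩ (toggled , away) = record
    { source  = λ s → trans (eq (i , s)) (onTile s)
    ; target  = λ s → trans (eqQ (i , s)) (flipped-source o cov i onTile s)
    ; outside = λ g out → trans (eq g) (trans (sym (flipped-outside o i λ s c → out s (≈⇒glued c))) (sym (eqQ g)))
    }
    where
    o : Fin n → Pair
    o = orientation X
    flipped≡ : ∀ j → orientation Y j ≡ flipped i o j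
    flipped≡ j with j ≟ i
    ... | yes refl = trans (cong (λ x → raise x (lowerPair i)) toggled)
                       (trans (sym (otherPair-raise (lookup X i) (lowerPair i))) (sym (updateAt-updates i o)))
    ... | no j≢i   = trans (cong (λ x → raise x (lowerPair j)) (away j j≢i)) (sym (updateAt-minimal j i o j≢i))
    tiles≡ : ∀ g → tiles (orientation Y) g ≡ tiles (flipped i o) g
    tiles≡ (j , s) = cong (s ∈ᴾ_) (flipped≡ j)
    onTile : ∀ s → matched o (i , s) ≡ s ∈ᴾ o i
    onTile = flippable o i cov λ {e} {f} r → trans (sym (cong₂ _∨_ (tiles≡ e) (tiles≡ f))) (cov′ r)
    eqQ : ∀ g → member Q g ≡ matched (flipped i o) g
    eqQ g = trans (eq′ g) (joinAll-cong (loops w) tiles≡ g)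

  ≤ᴾ⇒⊑ : ∀ {X Y P Q} → Represents X P → Represents Y Q → _≤ᴾ_ w P Q → X ⊑ Y
  ≤ᴾ⇒⊑ rX rY (reflexive P≈Q) i x = subst (λ Z → lookup Z i ≡ true) (represents-injective rX rY P≈Q) x
  ≤ᴾ⇒⊑ {X} rX rY (flip {Q = Q} i F Q≤R) j x with Z , rZ ← represents Q
    with lower , (_ , away) ← flip-toggles rX rZ F with j ≟ i
  ... | no j≢i   = ≤ᴾ⇒⊑ rZ rY Q≤R j (trans (away j j≢i) x)
  -- An increasing flip at `i` starts from the lower pair, so `i` was not in `X`.
  ... | yes refl = contradiction (trans (sym x) (raise-injective {lookup X i} {false} (lowerPair i) lower)) λ ()

  -- Follows the arrows of M(w) inside Y ∖ X, along which the rank decreases.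
  findSink : ∀ {X Y} → Closed w Y → ∀ i → lookup Y i ≡ true → lookup X i ≡ false →
             ∃ λ j → lookup Y j ≡ true × lookup X j ≡ false ×
                     (∀ c → start w c ≡ j → lookup X (end w c) ≡ true)
  findSink {X} {Y} clY i y x = go i y x (<-wellFounded (rank w i))
    where
    go : ∀ i → lookup Y i ≡ true → lookup X i ≡ false → Acc ℕ._<_ (rank w i) →
         ∃ λ j → lookup Y j ≡ true × lookup X j ≡ false × (∀ c → start w c ≡ j → lookup X (end w c) ≡ true)
    go i y x (acc rec) with anyConnection? w (λ c → (start w c ≟ i) ×-dec (lookup X (end w c) ≟ᵇ false))
    ... | yes (c , refl , x′) = go (end w c) (clY c y) x′ (rec (rank-decreasing w c))
    ... | no none = i , y , x , λ c p → ¬-not λ q → none (c , p , q)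

  insert-closed : ∀ {X j} → Closed w X → (∀ c → start w c ≡ j → lookup X (end w c) ≡ true) →
                  Closed w (X [ j ]≔ true)
  insert-closed {X} {j} cl sink c p with start w c ≟ j
  ... | yes q = ⊑-insert X j (end w c) (sink c q)
  ... | no ¬q = ⊑-insert X j (end w c) (cl c (trans (sym (lookup∘update′ ¬q X true)) p))

  -- All connections starting at the sink lead into `X`, so inserting it keeps the set closed and
  -- stays inside `Y`. The process ends because a finite set has no infinite ascent of subsets.
  climb : ∀ {X Y P Q} → Acc _⊃_ X → Represents X P → Represents Y Q → X ⊑ Y → _≤ᴾ_ w P Q
  climb {X} {Y} {P} {Q} (acc rec) rX rY X⊑Y with any? (λ i → (lookup Y i ≟ᵇ true) ×-dec (lookup X i ≟ᵇ false))
  ... | no none = reflexive (represents-≈ rX (subst (λ Z → Represents Z Q) (sym X≡Y) rY))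
    where
    X≡Y : X ≡ Y
    X≡Y = lookup-injective pointwise
      where
      pointwise : ∀ i → lookup X i ≡ lookup Y i
      pointwise i with lookup X i in x | lookup Y i in y
      ... | true  | true  = refl
      ... | true  | false = contradiction (trans (sym (X⊑Y i x)) y) λ ()
      ... | false | true  = contradiction (i , y , x) none
      ... | false | false = refl
  ... | yes (i , y , x) with j , yj , xj , sink ← findSink {X} {Y} (represents-closed rY) i y x
    with P′ , rZ ← closed-represents (insert-closed {X} (represents-closed rX) sink)
    = flip j (subst (λ o → Flip w j o P P′) (cong (λ b → raise b (lowerPair j)) xj)
               (toggle-flips rX rZ (trans (lookup∘update j X true) (sym (cong not xj)) , λ k k≢j → lookup∘update′ k≢j X true)))
             (climb (rec Z⊃X) rZ rY Z⊑Y)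
    where
    Z⊃X : (X [ j ]≔ true) ⊃ X
    Z⊃X = (λ {k} p → lookup⇒[]= k _ (⊑-insert X j k ([]=⇒lookup p))) ,
          j , lookup⇒[]= j _ (lookup∘update j X true) , λ p → contradiction (trans (sym ([]=⇒lookup p)) xj) λ ()
    Z⊑Y : (X [ j ]≔ true) ⊑ Y
    Z⊑Y k p with k ≟ j
    ... | yes refl = yj
    ... | no k≢j   = X⊑Y k (trans (sym (lookup∘update′ k≢j X true)) p)

  ⊑⇒≤ᴾ : ∀ {X Y P Q} → Represents X P → Represents Y Q → X ⊑ Y → _≤ᴾ_ w P Q
  ⊑⇒≤ᴾ {X} = climb (⊃-wellFounded X)

-- Submodules spanned by basis vectors

module _ {c ℓ₁ ℓ₂} (K : HeytingField c ℓ₁ ℓ₂) {Q : Quiver} (w : LoopstringIn Q) where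
  open HeytingField K using (Carrier; _≈_; _*_; 0#; 1#; heytingCommutativeRing; invertible⇒#; #-irrefl)
  open CommutativeRing (HeytingCommutativeRing.commutativeRing heytingCommutativeRing)
    using (semiring; +-cong; *-congˡ; *-identityˡ; *-identityʳ; +-identityˡ; +-identityʳ; zeroˡ; zeroʳ; -‿inverseʳ; _-_)
    renaming (refl to ≈-refl; sym to ≈-sym; trans to ≈-trans; reflexive to ≈-reflexive)
  open Sum semiring using (sum; sum-remove; sum-cong-≋; sum-replicate-zero)
  open Quiver Q
  open LoopstringIn w

  private
    variable
      X Y : Subset n
      v : Space K w

  -- Nontriviality comes from the apartness: an invertible difference makes two elements apart, and
  -- if `1#` equalled `0#`, then `1# - 0#` would be invertible with inverse `1#`, against
  -- irreflexivity.
  1≉0 : ¬ 1# ≈ 0#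
  1≉0 1≈0 = #-irrefl 1≈0 (invertible⇒# (1# , (≈-trans (*-identityˡ _) 1-0≈1 , ≈-trans (*-identityʳ _) 1-0≈1)))
    where
    1-0≈1 : 1# - 0# ≈ 1#
    1-0≈1 = ≈-trans (+-cong 1≈0 ≈-refl) (≈-trans (-‿inverseʳ 0#) (≈-sym 1≈0))

  sum-zero : ∀ {k} (t : Vector Carrier k) → (∀ i → t i ≈ 0#) → sum t ≈ 0#
  sum-zero {k} t t≈0 = ≈-trans (sum-cong-≋ t≈0) (sum-replicate-zero k)

  sum-single : ∀ {k} (t : Vector Carrier (ℕ.suc k)) j → (∀ i → i ≢ j → t i ≈ 0#) → sum t ≈ t j
  sum-single t j t≈0 = ≈-trans (sum-remove {i = j} t)
    (≈-trans (+-cong ≈-refl (sum-zero (removeAt t j) (λ i → t≈0 (punchIn j i) (punchInᵢ≢i j i)))) (+-identityʳ _))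

  basis-self : ∀ i → basis K w i i ≈ 1#
  basis-self i = ≈-reflexive (cong (if_then 1# else 0#) (dec-true (i ≟ i) refl))

  basis-other : ∀ {i j} → i ≢ j → basis K w i j ≈ 0#
  basis-other {i} {j} i≢j = ≈-reflexive (cong (if_then 1# else 0#) (dec-false (i ≟ j) i≢j))

  combination : ∀ (a : Vector Carrier n) j → sum (λ i → a i * basis K w i j) ≈ a j
  combination a j = ≈-trans (sum-single _ j (λ i i≢j → ≈-trans (*-congˡ {a i} (basis-other i≢j)) (zeroʳ _)))
                          (≈-trans (*-congˡ {a j} (basis-self j)) (*-identityʳ _))

  selected : ∀ {A : Set} {x} (d : Dec A) → (A → x ≈ 0#) → (if does d then 1# else 0#) * x ≈ 0#
  selected (yes a) x≈0 = ≈-trans (*-congˡ (x≈0 a)) (zeroʳ 1#)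
  selected (no _)  _   = zeroˡ _

  -- The span as a condition on coordinates, which can be checked for each operation without
  -- handling coefficients.
  Vanishes : Subset n → Space K w → Set ℓ₁
  Vanishes X v = ∀ j → lookup X j ≡ false → v j ≈ 0#

  ∉⇒false : ∀ {j} → j ∉ X → lookup X j ≡ false
  ∉⇒false {X = X} {j} j∉ = ¬-not λ p → j∉ (lookup⇒[]= j X p)

  false⇒∉ : ∀ {j} → lookup X j ≡ false → j ∉ X
  false⇒∉ p j∈ = contradiction (trans (sym p) ([]=⇒lookup j∈)) λ ()

  span⇒vanishes : Span K w X v → Vanishes X v
  span⇒vanishes (a , a≈0 , v≋) j p = ≈-trans (v≋ j) (≈-trans (combination a j) (a≈0 j (false⇒∉ p)))

  vanishes⇒span : Vanishes X v → Span K w X v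
  vanishes⇒span {v = v} van = v , (λ j j∉ → van j (∉⇒false j∉)) , λ j → ≈-sym (combination v j)

  basis-vanishes : ∀ {i} → lookup X i ≡ true → Vanishes X (basis K w i)
  basis-vanishes {i = i} p j q = basis-other {i} {j} λ { refl → contradiction (trans (sym p) q) λ () }

  basis-vanishes⁻ : ∀ {i} → Vanishes X (basis K w i) → lookup X i ≡ true
  basis-vanishes⁻ {i = i} van = ¬-not λ p → 1≉0 (≈-trans (≈-sym (basis-self i)) (van i p))

  ⊑⇒span : X ⊑ Y → ∀ v → Span K w X v → Span K w Y v
  ⊑⇒span {X = X} {Y} X⊑Y v sp = vanishes⇒span λ j p → span⇒vanishes sp j
    (¬-not λ q → contradiction (trans (sym (X⊑Y j q)) p) λ ())

  span⇒⊑ : (∀ v → Span K w X v → Span K w Y v) → X ⊑ Y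
  span⇒⊑ {X = X} {Y} X⊆Y i p = basis-vanishes⁻ {X = Y} {i} (span⇒vanishes (X⊆Y _ (vanishes⇒span (basis-vanishes {X = X} p))))

  module _ {X} (closed : Closed loopstring X) where

    -- A nonzero matrix entry comes from a connection, and as `X` is closed, a connection that ends
    -- outside `X` also starts outside it.
    actArrow-vanishes : ∀ β → Vanishes X v → Vanishes X (actArrow K w β v)
    actArrow-vanishes {v} β van j p = sum-zero _ λ i → selected {x = v i} (connects? K w β i j) λ
      { (e , _ , refl , refl) → van i (¬-not λ q → contradiction (trans (sym (closed e q)) p) λ ()) }

    actPath-vanishes : ∀ {x y} (p : Path x y) → Vanishes X v → Vanishes X (actPath K w p v)
    actPath-vanishes {x = x} ε van j q with does (vertexAt j ≟ x)
    ... | true  = van j q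
    ... | false = ≈-refl
    actPath-vanishes ((β , _) ◅ p) van = actPath-vanishes p (actArrow-vanishes β van)

    act-vanishes : ∀ f → Vanishes X v → Vanishes X (act K w f v)
    act-vanishes []                    van j q = ≈-refl
    act-vanishes ((a , _ , _ , p) ∷ f) van j q = ≈-trans
      (+-cong (≈-trans (*-congˡ (actPath-vanishes p van j q)) (zeroʳ a)) (act-vanishes f van j q)) (+-identityˡ 0#)

    closed⇒submodule : IsSubmodule K w (Span K w X)
    closed⇒submodule = record
      { respects   = λ v≋v′ sp → vanishes⇒span λ j p → ≈-trans (≈-sym (v≋v′ j)) (span⇒vanishes sp j p)
      ; zero∈      = vanishes⇒span λ _ _ → ≈-refl
      ; +-closed   = λ sp sp′ → vanishes⇒span λ j p →
          ≈-trans (+-cong (span⇒vanishes sp j p) (span⇒vanishes sp′ j p)) (+-identityˡ 0#)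
      ; *-closed   = λ a sp → vanishes⇒span λ j p → ≈-trans (*-congˡ (span⇒vanishes sp j p)) (zeroʳ a)
      ; act-closed = λ f sp → vanishes⇒span (act-vanishes f (span⇒vanishes sp))
      }

  -- The arrow of a connection sends the basis vector at its start to a vector with coordinate `1#`
  -- at its end, which is nonzero, so the end lies in the support.
  submodule⇒closed : IsSubmodule K w (Span K w X) → Closed loopstring X
  submodule⇒closed {X} sub e p = ¬-not λ q → 1≉0 (≈-trans (≈-sym act≈1)
      (span⇒vanishes (IsSubmodule.act-closed sub f (vanishes⇒span (basis-vanishes {X = X} p))) t q))
    where
    s = start loopstring e
    t = end loopstring e
    β = arrowOf e
    f = path K Q (source β , target β , (β , refl , refl) ◅ ε)
    entry≈1 : matrix K w β t s ≈ 1#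
    entry≈1 = ≈-reflexive (cong (if_then 1# else 0#) (dec-true (connects? K w β s t) (e , refl , refl , refl)))
    arrow≈1 : actArrow K w β (basis K w s) t ≈ 1#
    arrow≈1 = ≈-trans (sum-single _ s (λ i i≢s → ≈-trans (*-congˡ {matrix K w β t i} (basis-other (i≢s ∘ sym))) (zeroʳ _)))
                    (≈-trans (*-congˡ (basis-self s)) (≈-trans (*-identityʳ _) entry≈1))
    -- The path of length one still ends in a trivial path, which projects to the vertex `target β`;
    -- by `arrow-target` the position `t` lies there and its coordinate survives.
    act≈1 : act K w f (basis K w s) t ≈ 1#
    act≈1 = ≈-trans (+-identityʳ _) (≈-trans (*-identityˡ _) (≈-trans
      (≈-reflexive (cong (if_then actArrow K w β (basis K w s) t else 0#)
                         (dec-true (vertexAt t ≟ target β) (sym (arrow-target e))))) arrow≈1))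

-- The isomorphism between matchings and canonical submodules

theorem1p0p1 : ∀ {c ℓ₁ ℓ₂ ℓ} (K : HeytingField c ℓ₁ ℓ₂) → AlgebraicallyClosed K →
    (A : BoundQuiver K ℓ) (w : LoopstringOver A) →
    let open LoopstringOver w in
    Σ (Bijection (matchings loopstring) (canonicalSubmodules K realisation)) λ φ →
    let open Bijection φ in
    (∀ P Q → _≤ᴾ_ loopstring P Q ⇔ _≤ᴹ_ K realisation (to P) (to Q)) ×
    (∀ P Q → HasseEdgeᴾ loopstring P Q ⇔ HasseEdgeᴹ K realisation (to P) (to Q))
theorem1p0p1 K _ A w = φ , order , hasse
  where
  open LoopstringOver w
  open CanonicalSubmodule

  subset : LoopMatching loopstring → Subset (Loopstring.n loopstring)
  subset P = proj₁ (represents loopstring P)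

  subset-represents : ∀ P → Represents loopstring (subset P) P
  subset-represents P = proj₂ (represents loopstring P)

  submodule : LoopMatching loopstring → CanonicalSubmodule K realisation
  submodule P = record
    { support     = subset P
    ; isSubmodule = closed⇒submodule K realisation (represents-closed loopstring (subset-represents P))
    }

  φ : Bijection (matchings loopstring) (canonicalSubmodules K realisation)
  φ = record
    { to        = submodule
    ; cong      = λ {P} {Q} → represents-injective loopstring (subset-represents P) (subset-represents Q)
    ; bijective =
        (λ {P} {Q} eq → represents-≈ loopstring (subset-represents P)
          (subst (λ X → Represents loopstring X Q) (sym eq) (subset-represents Q))) ,
        -- The support of `U` is closed, hence represented by some `P`; as the represented set is
        -- unique, `P` is sent back to `U`.
        (λ U → case closed-represents loopstring (submodule⇒closed K realisation (isSubmodule U)) of λ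
          { (P , rP) → P , λ {Q} → represents-injective loopstring (subset-represents Q) rP })
    }

  order : ∀ P Q → _≤ᴾ_ loopstring P Q ⇔ _≤ᴹ_ K realisation (submodule P) (submodule Q)
  order P Q = mk⇔
    (λ P≤Q → ⊑⇒span K realisation (≤ᴾ⇒⊑ loopstring (subset-represents P) (subset-represents Q) P≤Q))
    (λ P⊆Q → ⊑⇒≤ᴾ loopstring (subset-represents P) (subset-represents Q) (span⇒⊑ K realisation P⊆Q))

  hasse : ∀ P Q → HasseEdgeᴾ loopstring P Q ⇔ HasseEdgeᴹ K realisation (submodule P) (submodule Q)
  hasse P Q = mk⇔
    (λ { (i , _ , F) → toggles⇒edge (proj₂ (flip-toggles loopstring (subset-represents P) (subset-represents Q) F)) })
    -- Differing Booleans are complementary, and uniqueness of `i` gives agreement elsewhere. The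
    -- pair to be flipped is the present state of tile `i`.
    (λ { (i , differ , only) → i , _ , toggle-flips loopstring (subset-represents P) (subset-represents Q)
      ( ¬-not (differ ∘ sym)
      , λ j j≢i → decidable-stable (_ ≟ᵇ _) λ j-differs → j≢i (sym (only (j-differs ∘ sym)))) })
    where
    toggles⇒edge : ∀ {i} → Toggles loopstring i (subset P) (subset Q) → HasseEdgeᴹ K realisation (submodule P) (submodule Q)
    toggles⇒edge {i} (toggled , away) = i , (λ eq → not-¬ refl (trans eq toggled)) ,
      λ {j} j-differs → decidable-stable (i ≟ j) λ i≢j → j-differs (sym (away j (i≢j ∘ sym)))
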